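{- Let $n\ge 4$ be an integer with $n\equiv 2,6,10,14,18,26,30,34,38,42,46$ or $54 \pmod{56}$. Then there exists a configuration $(2,4)$ $GDD\left(n,2,6;\frac{7n}{2},4(n-1)\right)$.
   Context: A $GDD(n,2,6;\lambda_1,\lambda_2)$ is a finite collection (repetitions allowed) of $6$-element subsets, called blocks, of a $2n$-element set $X$ partitioned into two groups of size $n$, such that every point lies in the same number $r$ of blocks, any two distinct points of the same group lie together in exactly $\lambda_1$ blocks, and any two points from different groups lie together in exactly $\lambda_2$ blocks. It has configuration $(2,4)$ if every block has exactly $2$ points in one of the two groups and $4$ points in the other (which group contains the $2$ points may depend on the block). -}

module Defs where

open import Data.Fin using (Fin; zero; suc; _≟_)
open import Data.Fin.Subset using (Subset; _∩_; ∣_∣)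
open import Data.Fin.Subset.Properties using (_∈?_)
open import Data.List using (List; length; filter)
open import Data.List.Relation.Unary.All using (All)
open import Data.Nat using (ℕ; _*_)
open import Data.Product using (_×_)
open import Data.Sum using (_⊎_)
open import Data.Vec using (tabulate)
open import Relation.Binary.PropositionalEquality using (_≡_; _≢_)
open import Relation.Nullary.Decidable using (does; _×-dec_)

-- Both counts are with multiplicity.
degree : ∀ {v} → List (Subset v) → Fin v → ℕ
degree blocks x = length (filter (λ B → x ∈? B) blocks)

pairDegree : ∀ {v} → List (Subset v) → Fin v → Fin v → ℕ
pairDegree blocks x y = length (filter (λ B → (x ∈? B) ×-dec (y ∈? B)) blocks)

-- A GDD(n, m, k; λ₁, λ₂).  The point set is taken to be Fin (m * n); the
-- partition into m groups is given by the map sending a point to its group.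
-- Repeated blocks are allowed, so the blocks form a list; its order is
-- irrelevant to every condition.
record GDD (n m k λ₁ λ₂ : ℕ) : Set where
  field
    groupOf : Fin (m * n) → Fin m
    blocks  : List (Subset (m * n))
    r       : ℕ

  group : Fin m → Subset (m * n)
  group i = tabulate (λ x → does (groupOf x ≟ i))

  field
    group-size  : ∀ i → ∣ group i ∣ ≡ n
    block-size  : All (λ B → ∣ B ∣ ≡ k) blocks
    replication : ∀ x → degree blocks x ≡ r
    same-group  : ∀ x y → x ≢ y → groupOf x ≡ groupOf y →
                  pairDegree blocks x y ≡ λ₁
    diff-group  : ∀ x y → groupOf x ≢ groupOf y →
                  pairDegree blocks x y ≡ λ₂

-- The choice of which group meets the block in s points is made per block.
HasConfiguration : ∀ {n k λ₁ λ₂} → ℕ → ℕ → GDD n 2 k λ₁ λ₂ → Set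
HasConfiguration s t D = All Split blocks
  where
  open GDD D

  Split : Subset _ → Set
  Split B = (∣ B ∩ group zero ∣ ≡ s × ∣ B ∩ group (suc zero) ∣ ≡ t)
          ⊎ (∣ B ∩ group zero ∣ ≡ t × ∣ B ∩ group (suc zero) ∣ ≡ s)

{-# OPTIONS --safe #-}
module Submission where

-- Let n = q + 1 be even.  If the n(n-1)/2 blocks of a design with block size 4 and
-- index 6 on n points are distributed over the q one-factors Fᵢ of a
-- one-factorization of Kₙ, n/2 blocks in each class Qᵢ, then the sets B ∪ e with
-- B ∈ Qᵢ on one group and e ∈ Fᵢ on the other form the required GDD: two points of
-- one group lie together in 6(n/2) + n/2 blocks, two points of different groups in
-- 2q + 2q blocks.  Both ingredients are developed from base blocks on G ∪ {∞}, G an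
-- abelian group of odd order q, and Qᵢ, Fᵢ are the translates by i ∈ G.  If G has an
-- automorphism α with 1 ± α bijective, the quads {± d, ± α d} have every nonzero
-- difference 6 times.  Such an α is 2 on ℤ/s with s coprime to 6, and multiplication
-- by √-1 on 𝔽₉; this reaches all odd orders up to one factor 3, and an extra
-- factor ℤ/3 is treated separately.

open import Defs
open import Algebra.Bundles using (AbelianGroup)
open import Algebra.Consequences.Propositional using (comm∧idˡ⇒id; comm∧invˡ⇒inv)
open import Algebra.Definitions using (Associative; Commutative; LeftIdentity; LeftInverse)
import Algebra.Properties.AbelianGroup as AbelianGroupProperties
import Algebra.Solver.CommutativeMonoid as CommutativeMonoidSolver
open import Algebra.Structures using (IsAbelianGroup)
open import Data.Bool using (Bool; true; false; _∧_)
open import Data.Fin as Fin using (Fin; zero; suc; toℕ; opposite)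
import Data.Fin.Properties as Fin
open import Data.Fin.Properties using (*↔×; toℕ-injective; toℕ-fromℕ<; toℕ<n; all?)
open import Data.Fin.Subset using (Subset; ∣_∣; _∩_)
import Data.Fin.Subset.Properties as Subset
open import Data.List using (List; []; _∷_; _++_; map; concatMap; length; filter; allFin)
import Data.List.Membership.DecPropositional as DecMembership
open import Data.List.Membership.Propositional using (_∈_; _∉_)
open import Data.List.Membership.Propositional.Properties using (∈-map⁺; ∈-map⁻; ∈-allFin)
open import Data.List.Properties using (map-tabulate; map-++; map-∘; length-map; length-++; length-tabulate)
open import Data.List.Relation.Binary.Disjoint.Propositional using (Disjoint)
open import Data.List.Relation.Unary.All as All using (All; []; _∷_)
import Data.List.Relation.Unary.All.Properties as All
open import Data.List.Relation.Unary.AllPairs using ([]; _∷_)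
open import Data.List.Relation.Unary.Any using (here; there)
open import Data.List.Relation.Unary.Unique.Propositional using (Unique)
import Data.List.Relation.Unary.Unique.Propositional.Properties as Unique
open import Data.Maybe using (Maybe; just; nothing)
open import Data.Maybe.Properties using (just-injective)
open import Data.Nat using (ℕ; zero; suc; _+_; _*_; _∸_; _≤_; _<_; s≤s)
open import Data.Nat.DivMod 
  using (_/_; _%_; _mod_; _divMod_; result; m%n<n; m%n%n≡m%n; m<n⇒m%n≡m; [m+kn]%n≡m%n;
         %-distribˡ-+; %-distribˡ-*; m≡m%n+[m/n]*n; m*n/n≡m)
open import Data.Nat.Divisibility using (_∣_; _∣?_; divides; divides-refl; ∣m∣n⇒∣m+n; ∣n⇒∣m*n)
open import Data.Nat.Induction using (<-rec)
open import Data.Nat.ListAction using (sum)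
open import Data.Nat.ListAction.Properties using (sum-++)
open import Data.Nat.Properties 
  using (suc-injective; m≤m*n; +-assoc; +-comm; +-identityʳ; *-assoc; *-comm; *-identityˡ;
         *-identityʳ; *-zeroʳ; *-cancelʳ-≡; *-distribˡ-+; *-distribʳ-+)
open import Data.Nat.Solver using (module +-*-Solver)
open import Data.Product as Product using (_×_; _,_; proj₁; proj₂; Σ; ∃)
open import Data.Product.Function.NonDependent.Propositional using (_×-↔_)
open import Data.Product.Properties using (≡-dec)
open import Data.Sum using (_⊎_; inj₁; inj₂)
open import Data.Unit using (tt)
import Data.Vec as Vec
open import Function using (_∘_; _↔_; mk↔ₛ′; Inverse)
open import Function.Construct.Composition using (_↔-∘_)
open import Function.Construct.Identity using (↔-id)
open import Function.Construct.Symmetry using (↔-sym)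
open import Function.Properties.Inverse using (↔⇒↣)
open import Level using (Level; 0ℓ)
open import Relation.Binary.Definitions using (DecidableEquality; tri<; tri≈; tri>)
open import Relation.Binary.PropositionalEquality hiding ([_])
open import Relation.Nullary using (Dec; yes; no; does; ¬_; contradiction)
open import Relation.Nullary.Decidable using (True; toWitness; from-yes; via-injection; _×-dec_)
open import Relation.Unary using (Decidable)

open ≡-Reasoning

-- Which quads are paired with which one-factor does not matter beyond the class sizes. For x and y
-- in different groups, every quad through x is joined to exactly one edge through y, because the
-- one-factor of its class covers y once.
--
-- The index 6 is a count of differences: {± d, ± α d} has ± 2d and ± 2α d once and ± (d + α d) and
-- ± (d - α d) twice. With d running over one element of each pair ± d, each of these signed
-- expressions runs once over the nonzero elements, which gives 1 + 1 + 2 + 2. These are (q - 1)/2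
-- quads, one fewer than n/2, and none contains ∞; exchanging a single quad for two triples
-- completed by ∞ corrects both, since ∞ then meets every point 2 · 3 times.
--
-- The obstacle is ℤ/3, whose only automorphisms are ± 1, so that 1 + α or 1 - α vanishes. On G ×
-- ℤ/3 each quad is therefore spread over two levels of ℤ/3. This yields every difference outside
-- the fibre {0} × ℤ/3 twice and none inside it; three copies give 6, and the fibre, completed by ∞
-- and used twice, supplies the rest.

private variable
  a p : Level
  A B C : Set a
  P Q : Set p
  n : ℕ

-- Finite sums

bit : Bool → ℕ
bit true  = 1
bit false = 0

⟦_⟧ : Dec P → ℕ
⟦ d ⟧ = bit (does d)

⟦⟧-yes : (d : Dec P) → P → ⟦ d ⟧ ≡ 1
⟦⟧-yes (yes _) _ = refl
⟦⟧-yes (no ¬p) p = contradiction p ¬p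

⟦⟧-no : (d : Dec P) → ¬ P → ⟦ d ⟧ ≡ 0
⟦⟧-no (yes p) ¬p = contradiction p ¬p
⟦⟧-no (no _)  _  = refl

⟦⟧-⇔ : (d : Dec P) (e : Dec Q) → (P → Q) → (Q → P) → ⟦ d ⟧ ≡ ⟦ e ⟧
⟦⟧-⇔ d (yes q) _ g = ⟦⟧-yes d (g q)
⟦⟧-⇔ d (no ¬q) f _ = ⟦⟧-no d (¬q ∘ f)

bit-∧ : ∀ x y → bit (x ∧ y) ≡ bit x * bit y
bit-∧ true  y = sym (*-identityˡ (bit y))
bit-∧ false y = refl

∑ : List A → (A → ℕ) → ℕ
∑ xs f = sum (map f xs)

∑-cong : ∀ (xs : List A) {f g : A → ℕ} → (∀ x → f x ≡ g x) → ∑ xs f ≡ ∑ xs g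
∑-cong []       _  = refl
∑-cong (x ∷ xs) eq = cong₂ _+_ (eq x) (∑-cong xs eq)

∑-cong-All : ∀ {p} {P : A → Set p} {xs} {f g : A → ℕ} → All P xs →
             (∀ x → P x → f x ≡ g x) → ∑ xs f ≡ ∑ xs g
∑-cong-All []         _  = refl
∑-cong-All (px ∷ pxs) eq = cong₂ _+_ (eq _ px) (∑-cong-All pxs eq)

∑-const : ∀ (xs : List A) c → ∑ xs (λ _ → c) ≡ length xs * c
∑-const []       c = refl
∑-const (x ∷ xs) c = cong (c +_) (∑-const xs c)

∑-zero : ∀ (xs : List A) → ∑ xs (λ _ → 0) ≡ 0
∑-zero xs = trans (∑-const xs 0) (*-zeroʳ (length xs))

+-exchange : ∀ u v x y → (u + v) + (x + y) ≡ (u + x) + (v + y)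
+-exchange = solve 4 (λ u v x y → (u :+ v) :+ (x :+ y) := (u :+ x) :+ (v :+ y)) refl
  where open +-*-Solver using (solve; _:+_; _:=_)

∑-+ : ∀ (xs : List A) (f g : A → ℕ) → ∑ xs (λ x → f x + g x) ≡ ∑ xs f + ∑ xs g
∑-+ []       f g = refl
∑-+ (x ∷ xs) f g = trans (cong (f x + g x +_) (∑-+ xs f g)) (+-exchange (f x) (g x) _ _)

∑-*ˡ : ∀ (xs : List A) c (f : A → ℕ) → ∑ xs (λ x → c * f x) ≡ c * ∑ xs f
∑-*ˡ []       c f = sym (*-zeroʳ c)
∑-*ˡ (x ∷ xs) c f = trans (cong (c * f x +_) (∑-*ˡ xs c f)) (sym (*-distribˡ-+ c (f x) _))

∑-*ʳ : ∀ (xs : List A) c (f : A → ℕ) → ∑ xs (λ x → f x * c) ≡ ∑ xs f * c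
∑-*ʳ xs c f = trans (∑-cong xs (λ x → *-comm (f x) c)) (trans (∑-*ˡ xs c f) (*-comm c _))

∑-swap : ∀ (xs : List A) (ys : List B) (f : A → B → ℕ) →
         ∑ xs (λ x → ∑ ys (f x)) ≡ ∑ ys (λ y → ∑ xs (λ x → f x y))
∑-swap []       ys f = sym (∑-zero ys)
∑-swap (x ∷ xs) ys f =
  trans (cong (∑ ys (f x) +_) (∑-swap xs ys f)) (sym (∑-+ ys (f x) _))

∑-++ : ∀ (xs ys : List A) (f : A → ℕ) → ∑ (xs ++ ys) f ≡ ∑ xs f + ∑ ys f
∑-++ xs ys f = trans (cong sum (map-++ f xs ys)) (sum-++ (map f xs) _)

∑-map : ∀ (g : A → B) xs (f : B → ℕ) → ∑ (map g xs) f ≡ ∑ xs (f ∘ g)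
∑-map g xs f = cong sum (sym (map-∘ xs))

∑-concatMap : ∀ (g : A → List B) xs (f : B → ℕ) → ∑ (concatMap g xs) f ≡ ∑ xs (λ x → ∑ (g x) f)
∑-concatMap g []       f = refl
∑-concatMap g (x ∷ xs) f =
  trans (∑-++ (g x) (concatMap g xs) f) (cong (∑ (g x) f +_) (∑-concatMap g xs f))

∑-product : ∀ (xs : List A) (ys : List B) (f : A → ℕ) (g : B → ℕ) →
            ∑ xs f * ∑ ys g ≡ ∑ xs (λ x → ∑ ys (λ y → f x * g y))
∑-product xs ys f g =
  sym (trans (∑-cong xs (λ x → ∑-*ˡ ys (f x) g)) (∑-*ʳ xs (∑ ys g) f))

length-filter : ∀ {R : A → Set p} (R? : Decidable R) xs →
                length (filter R? xs) ≡ ∑ xs (λ x → ⟦ R? x ⟧)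
length-filter R? []       = refl
length-filter R? (x ∷ xs) with does (R? x)
... | true  = cong suc (length-filter R? xs)
... | false = length-filter R? xs

∑-filter : ∀ {R : A → Set p} (R? : Decidable R) xs (f : A → ℕ) →
           ∑ (filter R? xs) f ≡ ∑ xs (λ x → ⟦ R? x ⟧ * f x)
∑-filter R? []       f = refl
∑-filter R? (x ∷ xs) f with does (R? x)
... | true  = cong₂ _+_ (sym (*-identityˡ (f x))) (∑-filter R? xs f)
... | false = ∑-filter R? xs f

∑-allFin-suc : ∀ {n} (f : Fin (suc n) → ℕ) → ∑ (allFin (suc n)) f ≡ f zero + ∑ (allFin n) (f ∘ suc)
∑-allFin-suc {n} f = cong (λ l → f zero + sum l)
  (trans (map-tabulate suc f) (sym (map-tabulate (λ i → i) (f ∘ suc))))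

∑-allFin-δ : ∀ {n} (k : Fin n) (f : Fin n → ℕ) →
             ∑ (allFin n) (λ i → ⟦ i Fin.≟ k ⟧ * f i) ≡ f k
∑-allFin-δ {suc n} zero f = begin
  ∑ (allFin (suc n)) (λ i → ⟦ i Fin.≟ zero ⟧ * f i) ≡⟨ ∑-allFin-suc (λ i → ⟦ i Fin.≟ zero ⟧ * f i) ⟩
  1 * f zero + ∑ (allFin n) (λ _ → 0)              ≡⟨ cong₂ _+_ (*-identityˡ (f zero)) (∑-zero (allFin n)) ⟩
  f zero + 0                                       ≡⟨ +-identityʳ _ ⟩
  f zero                                           ∎
∑-allFin-δ {suc n} (suc k) f = begin
  ∑ (allFin (suc n)) (λ i → ⟦ i Fin.≟ suc k ⟧ * f i) ≡⟨ ∑-allFin-suc (λ i → ⟦ i Fin.≟ suc k ⟧ * f i) ⟩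
  ∑ (allFin n) (λ i → ⟦ suc i Fin.≟ suc k ⟧ * f (suc i))
    ≡⟨ ∑-cong (allFin n) (λ i → cong (_* f (suc i)) (⟦⟧-⇔ (suc i Fin.≟ suc k) (i Fin.≟ k) (λ { refl → refl }) (cong suc))) ⟩
  ∑ (allFin n) (λ i → ⟦ i Fin.≟ k ⟧ * f (suc i))     ≡⟨ ∑-allFin-δ k (f ∘ suc) ⟩
  f (suc k)                                          ∎

-- Lists of points as subsets

-- Counting with multiplicity makes incidence additive under `_++_` and stable under injective
-- `map`; for duplicate-free lists it agrees with membership by `⟦∈?⟧-mult`.
mult : DecidableEquality A → List A → A → ℕ
mult _≟_ L x = ∑ L (λ a → ⟦ a ≟ x ⟧)

module _ (_≟_ : DecidableEquality A) where
  open DecMembership _≟_ using (_∈?_)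

  mult-∉ : ∀ {x} L → x ∉ L → mult _≟_ L x ≡ 0
  mult-∉ []      _   = refl
  mult-∉ (a ∷ L) x∉ = cong₂ _+_ (⟦⟧-no (a ≟ _) (x∉ ∘ here ∘ sym)) (mult-∉ L (x∉ ∘ there))

  mult-∈ : ∀ {x L} → Unique L → x ∈ L → mult _≟_ L x ≡ 1
  mult-∈ {x} {_ ∷ L} (a∉ ∷ _) (here refl) =
    cong₂ _+_ (⟦⟧-yes (x ≟ x) refl) (mult-∉ L λ x∈ → All.lookup a∉ x∈ refl)
  mult-∈ {x} {a ∷ L} (a∉ ∷ u) (there x∈) =
    cong₂ _+_ (⟦⟧-no (a ≟ x) (All.lookup a∉ x∈)) (mult-∈ u x∈)

  ⟦∈?⟧-mult : ∀ {L} → Unique L → ∀ x → ⟦ x ∈? L ⟧ ≡ mult _≟_ L x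
  ⟦∈?⟧-mult {L} u x with x ∈? L
  ... | yes x∈ = sym (mult-∈ u x∈)
  ... | no  x∉ = sym (mult-∉ L x∉)

module _ (_≟A_ : DecidableEquality A) (_≟B_ : DecidableEquality B) (f : A → B) where

  mult-map : (∀ {x y} → f x ≡ f y → x ≡ y) → ∀ L x →
             mult _≟B_ (map f L) (f x) ≡ mult _≟A_ L x
  mult-map inj L x = trans (∑-map f L (λ b → ⟦ b ≟B f x ⟧))
    (∑-cong L (λ a → ⟦⟧-⇔ (f a ≟B f x) (a ≟A x) inj (cong f)))

mult-map-∉ : (_≟_ : DecidableEquality B) (f : A → B) (L : List A) {y : B} →
             (∀ a → f a ≢ y) → mult _≟_ (map f L) y ≡ 0
mult-map-∉ _≟_ f L f≢y = mult-∉ _≟_ (map f L) λ y∈ →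
  let a , _ , y≡fa = ∈-map⁻ f y∈ in f≢y a (sym y≡fa)

mult-++ : (_≟_ : DecidableEquality A) (L M : List A) (x : A) →
          mult _≟_ (L ++ M) x ≡ mult _≟_ L x + mult _≟_ M x
mult-++ _≟_ L M x = ∑-++ L M (λ a → ⟦ a ≟ x ⟧)

∣tabulate∣ : (f : Fin n → Bool) → ∣ Vec.tabulate f ∣ ≡ ∑ (allFin n) (bit ∘ f)
∣tabulate∣ {zero}  f = refl
∣tabulate∣ {suc n} f = trans (lemma (f zero)) (sym (∑-allFin-suc (bit ∘ f)))
  where
  lemma : ∀ b → ∣ b Vec.∷ Vec.tabulate (f ∘ suc) ∣ ≡ bit b + ∑ (allFin n) (bit ∘ f ∘ suc)
  lemma true  = cong suc (∣tabulate∣ (f ∘ suc))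
  lemma false = ∣tabulate∣ (f ∘ suc)

tabulate-∩ : (f g : Fin n → Bool) →
             Vec.tabulate f ∩ Vec.tabulate g ≡ Vec.tabulate (λ i → f i ∧ g i)
tabulate-∩ {zero}  f g = refl
tabulate-∩ {suc n} f g = cong (f zero ∧ g zero Vec.∷_) (tabulate-∩ (f ∘ suc) (g ∘ suc))

does-∈?-tabulate : (f : Fin n → Bool) (i : Fin n) → does (i Subset.∈? Vec.tabulate f) ≡ f i
does-∈?-tabulate f zero with f zero
... | true  = refl
... | false = refl
does-∈?-tabulate f (suc i) = does-∈?-tabulate (f ∘ suc) i

-- The GDD lives on `Fin`, while the constructions live on groups, products and `Maybe`; the
-- enumeration `index` carries one to the other.
module Finite (index : A ↔ Fin n) where
  open Inverse index public using (to; from)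

  to∘from : ∀ i → to (from i) ≡ i
  to∘from = Inverse.strictlyInverseˡ index

  from∘to : ∀ x → from (to x) ≡ x
  from∘to = Inverse.strictlyInverseʳ index

  infix 4 _≟_
  _≟_ : DecidableEquality A
  _≟_ = via-injection (↔⇒↣ index) Fin._≟_

  open DecMembership _≟_ public using (_∈?_)

  elements : List A
  elements = map from (allFin n)

  length-elements : length elements ≡ n
  length-elements = trans (length-map from (allFin n)) (length-tabulate (λ i → i))

  ∑-δ : ∀ x (f : A → ℕ) → ∑ elements (λ a → ⟦ a ≟ x ⟧ * f a) ≡ f x
  ∑-δ x f = begin
    ∑ elements (λ a → ⟦ a ≟ x ⟧ * f a)                         ≡⟨ ∑-map from (allFin n) _ ⟩
    ∑ (allFin n) (λ i → ⟦ from i ≟ x ⟧ * f (from i))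
      ≡⟨ ∑-cong (allFin n) (λ i → cong (_* f (from i)) (⟦⟧-⇔ (from i ≟ x) (i Fin.≟ to x)
           (λ { refl → sym (to∘from i) }) (λ { refl → from∘to x }))) ⟩
    ∑ (allFin n) (λ i → ⟦ i Fin.≟ to x ⟧ * f (from i))         ≡⟨ ∑-allFin-δ (to x) (f ∘ from) ⟩
    f (from (to x))                                            ≡⟨ cong f (from∘to x) ⟩
    f x                                                        ∎

  ∑-δ₁ : ∀ x → ∑ elements (λ a → ⟦ a ≟ x ⟧) ≡ 1
  ∑-δ₁ x = trans (∑-cong elements (λ a → sym (*-identityʳ ⟦ a ≟ x ⟧))) (∑-δ x (λ _ → 1))

  subset : List A → Subset n
  subset L = Vec.tabulate (λ i → does (from i ∈? L))

  module _ {L : List A} (unique : Unique L) where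

    ⟦∈?⟧-subset : ∀ i → ⟦ i Subset.∈? subset L ⟧ ≡ mult _≟_ L (from i)
    ⟦∈?⟧-subset i =
      trans (cong bit (does-∈?-tabulate _ i)) (⟦∈?⟧-mult _≟_ unique (from i))

    ∑-members : (g : Fin n → ℕ) →
                ∑ (allFin n) (λ i → ⟦ from i ∈? L ⟧ * g i) ≡ ∑ L (g ∘ to)
    ∑-members g = begin
      ∑ (allFin n) (λ i → ⟦ from i ∈? L ⟧ * g i)
        ≡⟨ ∑-cong (allFin n) (λ i → trans (cong (_* g i) (⟦∈?⟧-mult _≟_ unique (from i)))
                                           (sym (∑-*ʳ L (g i) (λ a → ⟦ a ≟ from i ⟧)))) ⟩
      ∑ (allFin n) (λ i → ∑ L (λ a → ⟦ a ≟ from i ⟧ * g i))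
        ≡⟨ ∑-swap (allFin n) L _ ⟩
      ∑ L (λ a → ∑ (allFin n) (λ i → ⟦ a ≟ from i ⟧ * g i))
        ≡⟨ ∑-cong L (λ a → trans (∑-cong (allFin n) (λ i → cong (_* g i)
             (⟦⟧-⇔ (a ≟ from i) (i Fin.≟ to a) (λ { refl → sym (to∘from i) }) (λ { refl → sym (from∘to a) }))))
             (∑-allFin-δ (to a) g)) ⟩
      ∑ L (g ∘ to) ∎

    ∣subset∣ : ∣ subset L ∣ ≡ length L
    ∣subset∣ = begin
      ∣ subset L ∣                                 ≡⟨ ∣tabulate∣ (λ i → does (from i ∈? L)) ⟩
      ∑ (allFin n) (λ i → ⟦ from i ∈? L ⟧)         ≡⟨ ∑-cong (allFin n) (λ i → sym (*-identityʳ ⟦ from i ∈? L ⟧)) ⟩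
      ∑ (allFin n) (λ i → ⟦ from i ∈? L ⟧ * 1)     ≡⟨ ∑-members (λ _ → 1) ⟩
      ∑ L (λ _ → 1)                                ≡⟨ ∑-const L 1 ⟩
      length L * 1                                 ≡⟨ *-identityʳ _ ⟩
      length L                                     ∎

    ∣subset∩∣ : (g : Fin n → Bool) → ∣ subset L ∩ Vec.tabulate g ∣ ≡ ∑ L (bit ∘ g ∘ to)
    ∣subset∩∣ g = begin
      ∣ subset L ∩ Vec.tabulate g ∣                      ≡⟨ cong ∣_∣ (tabulate-∩ (λ i → does (from i ∈? L)) g) ⟩
      ∣ Vec.tabulate (λ i → does (from i ∈? L) ∧ g i) ∣  ≡⟨ ∣tabulate∣ (λ i → does (from i ∈? L) ∧ g i) ⟩
      ∑ (allFin n) (λ i → bit (does (from i ∈? L) ∧ g i)) ≡⟨ ∑-cong (allFin n) (λ i → bit-∧ (does (from i ∈? L)) (g i)) ⟩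
      ∑ (allFin n) (λ i → ⟦ from i ∈? L ⟧ * bit (g i))   ≡⟨ ∑-members (bit ∘ g) ⟩
      ∑ L (bit ∘ g ∘ to)                                 ∎

-- The group divisible design of a factored design

Simple : ℕ → List A → Set _
Simple k L = Unique L × length L ≡ k

∑³ : (is : List A) (js : A → List B) (ks : A → List C) (f : A → B → C → ℕ) → ℕ
∑³ is js ks f = ∑ is λ i → ∑ (js i) λ j → ∑ (ks i) λ k → f i j k

-- The quads of all classes form a 2-(n,4,6) design, the edges of each class a
-- one-factor of the complete graph.
record FactoredDesign (n h q : ℕ) : Set₁ where
  field
    {Point} : Set
    {Class} : Set
    index   : Point ↔ Fin n
    classes : List Class
    quads edges : Class → List (List Point)

  open Finite index using (_≟_)

  _#_ : Point → List Point → ℕ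
  x # L = mult _≟_ L x

  field
    length-quads : ∀ i → length (quads i) ≡ h
    length-edges : ∀ i → length (edges i) ≡ h
    quads-simple : ∀ i → All (Simple 4) (quads i)
    edges-simple : ∀ i → All (Simple 2) (edges i)
    quad-degree  : ∀ x → ∑ classes (λ i → ∑ (quads i) (x #_)) ≡ 2 * q
    edge-degree  : ∀ i x → ∑ (edges i) (x #_) ≡ 1
    quad-pairs   : ∀ x y → x ≢ y → ∑ classes (λ i → ∑ (quads i) λ L → x # L * y # L) ≡ 6
    edge-pairs   : ∀ x y → x ≢ y → ∑ classes (λ i → ∑ (edges i) λ L → x # L * y # L) ≡ 1

module _ {n h q : ℕ} (D : FactoredDesign n h q) where
  open FactoredDesign D
  private module P = Finite index

  index₂ : (Fin 2 × Point) ↔ Fin (2 * n)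
  index₂ = ↔-sym (*↔× {2} {n}) ↔-∘ (↔-id (Fin 2) ×-↔ index)

  open Finite index₂

  blockOn : Fin 2 → List Point → List Point → List (Fin 2 × Point)
  blockOn s B e = map (s ,_) B ++ map (opposite s ,_) e

  blocksOn : Fin 2 → List (List (Fin 2 × Point))
  blocksOn s = concatMap (λ i → concatMap (λ B → map (blockOn s B) (edges i)) (quads i)) classes

  blockLists : List (List (Fin 2 × Point))
  blockLists = blocksOn zero ++ blocksOn (suc zero)

  ∑-blocksOn : ∀ s (f : List (Fin 2 × Point) → ℕ) →
               ∑ (blocksOn s) f ≡ ∑³ classes quads edges (λ _ B e → f (blockOn s B e))
  ∑-blocksOn s f =
    trans (∑-concatMap _ classes f) (∑-cong classes λ i →
      trans (∑-concatMap _ (quads i) f) (∑-cong (quads i) λ B → ∑-map (blockOn s B) (edges i) f))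

  ∑-blockLists : (f : List (Fin 2 × Point) → ℕ) →
    ∑ blockLists f ≡ ∑³ classes quads edges (λ _ B e → f (blockOn zero B e))
                   + ∑³ classes quads edges (λ _ B e → f (blockOn (suc zero) B e))
  ∑-blockLists f = trans (∑-++ (blocksOn zero) _ f)
    (cong₂ _+_ (∑-blocksOn zero f) (∑-blocksOn (suc zero) f))

  s≢opposite : ∀ (s : Fin 2) → s ≢ opposite s
  s≢opposite zero ()
  s≢opposite (suc zero) ()

  mult-same : ∀ s B e x → mult _≟_ (blockOn s B e) (s , x) ≡ x # B
  mult-same s B e x = begin
    mult _≟_ (blockOn s B e) (s , x)
      ≡⟨ mult-++ _≟_ (map (s ,_) B) (map (opposite s ,_) e) (s , x) ⟩
    mult _≟_ (map (s ,_) B) (s , x) + mult _≟_ (map (opposite s ,_) e) (s , x)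
      ≡⟨ cong₂ _+_ (mult-map P._≟_ _≟_ (s ,_) (λ { refl → refl }) B x)
                   (mult-map-∉ _≟_ (opposite s ,_) e (λ _ eq → s≢opposite s (sym (cong proj₁ eq)))) ⟩
    x # B + 0
      ≡⟨ +-identityʳ _ ⟩
    x # B ∎

  mult-opposite : ∀ s B e x → mult _≟_ (blockOn s B e) (opposite s , x) ≡ x # e
  mult-opposite s B e x = begin
    mult _≟_ (blockOn s B e) (opposite s , x)
      ≡⟨ mult-++ _≟_ (map (s ,_) B) (map (opposite s ,_) e) (opposite s , x) ⟩
    mult _≟_ (map (s ,_) B) (opposite s , x) + mult _≟_ (map (opposite s ,_) e) (opposite s , x)
      ≡⟨ cong₂ _+_ (mult-map-∉ _≟_ (s ,_) B (λ _ eq → s≢opposite s (cong proj₁ eq)))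
                   (mult-map P._≟_ _≟_ (opposite s ,_) (λ { refl → refl }) e x) ⟩
    x # e ∎

  -- Each quad is joined to all h edges of its class, so a quantity that depends only on the quad is
  -- repeated h times. `∑³-edge` is the same with the roles exchanged.
  ∑³-quad : (f : Class → List Point → ℕ) →
            ∑³ classes quads edges (λ i B _ → f i B) ≡ h * ∑ classes (λ i → ∑ (quads i) (f i))
  ∑³-quad f = trans (∑-cong classes λ i → trans (∑-cong (quads i) λ B →
      trans (∑-const (edges i) (f i B)) (cong (_* f i B) (length-edges i)))
      (∑-*ˡ (quads i) h (f i)))
    (∑-*ˡ classes h _)

  ∑³-edge : (f : Class → List Point → ℕ) →
            ∑³ classes quads edges (λ i _ e → f i e) ≡ h * ∑ classes (λ i → ∑ (edges i) (f i))
  ∑³-edge f = trans (∑-cong classes λ i →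
      trans (∑-const (quads i) (∑ (edges i) (f i))) (cong (_* ∑ (edges i) (f i)) (length-quads i)))
    (∑-*ˡ classes h _)

  ∑-edge-degree : ∀ x → ∑ classes (λ i → ∑ (edges i) (x #_)) ≡ length classes
  ∑-edge-degree x = trans (∑-cong classes λ i → edge-degree i x)
    (trans (∑-const classes 1) (*-identityʳ _))

  replicationNumber : ℕ
  replicationNumber = h * (2 * q) + h * length classes

  ∑³-degree-quad : ∀ x → ∑³ classes quads edges (λ _ B _ → x # B) ≡ h * (2 * q)
  ∑³-degree-quad x = trans (∑³-quad (λ _ → x #_)) (cong (h *_) (quad-degree x))

  ∑³-degree-edge : ∀ x → ∑³ classes quads edges (λ _ _ e → x # e) ≡ h * length classes
  ∑³-degree-edge x = trans (∑³-edge (λ _ → x #_)) (cong (h *_) (∑-edge-degree x))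

  ∑³-cong : ∀ {f g : Class → List Point → List Point → ℕ} → (∀ i B e → f i B e ≡ g i B e) →
            ∑³ classes quads edges f ≡ ∑³ classes quads edges g
  ∑³-cong eq = ∑-cong classes λ i → ∑-cong (quads i) λ B → ∑-cong (edges i) (eq i B)

  ∑-degree : ∀ p → ∑ blockLists (λ L → mult _≟_ L p) ≡ replicationNumber
  ∑-degree (zero , x) = trans (∑-blockLists _) (cong₂ _+_
    (trans (∑³-cong λ _ B e → mult-same zero B e x) (∑³-degree-quad x))
    (trans (∑³-cong λ _ B e → mult-opposite (suc zero) B e x) (∑³-degree-edge x)))
  ∑-degree (suc zero , x) = trans (∑-blockLists _) (trans (cong₂ _+_
    (trans (∑³-cong λ _ B e → mult-opposite zero B e x) (∑³-degree-edge x))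
    (trans (∑³-cong λ _ B e → mult-same (suc zero) B e x) (∑³-degree-quad x)))
    (+-comm (h * length classes) _))

  ∑³-pairs-quad : ∀ x y → x ≢ y → ∑³ classes quads edges (λ _ B _ → x # B * y # B) ≡ h * 6
  ∑³-pairs-quad x y x≢y = trans (∑³-quad _) (cong (h *_) (quad-pairs x y x≢y))

  ∑³-pairs-edge : ∀ x y → x ≢ y → ∑³ classes quads edges (λ _ _ e → x # e * y # e) ≡ h * 1
  ∑³-pairs-edge x y x≢y = trans (∑³-edge _) (cong (h *_) (edge-pairs x y x≢y))

  h6+h1≡7h : h * 6 + h * 1 ≡ 7 * h
  h6+h1≡7h = solve 1 (λ h → h :* con 6 :+ h :* con 1 := con 7 :* h) refl h
    where open +-*-Solver using (solve; _:+_; _:*_; _:=_; con)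

  -- Once a quad through x is fixed, exactly one edge of its class contains y, since these edges
  -- form a one-factor. What remains is the number of quads through x.
  ∑³-mixed : ∀ x y → ∑³ classes quads edges (λ _ B e → x # B * y # e) ≡ 2 * q
  ∑³-mixed x y = trans (∑-cong classes λ i → ∑-cong (quads i) λ B →
      trans (∑-*ˡ (edges i) (x # B) (y #_))
        (trans (cong (x # B *_) (edge-degree i y)) (*-identityʳ _)))
    (quad-degree x)

  ∑³-mixed′ : ∀ x y → ∑³ classes quads edges (λ _ B e → x # e * y # B) ≡ 2 * q
  ∑³-mixed′ x y = trans (∑³-cong λ _ B e → *-comm (x # e) (y # B)) (∑³-mixed y x)

  2q+2q≡4q : 2 * q + 2 * q ≡ 4 * q
  2q+2q≡4q = solve 1 (λ q → con 2 :* q :+ con 2 :* q := con 4 :* q) refl q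
    where open +-*-Solver using (solve; _:+_; _:*_; _:=_; con)

  mult² : Fin 2 × Point → Fin 2 × Point → List (Fin 2 × Point) → ℕ
  mult² p p′ L = mult _≟_ L p * mult _≟_ L p′

  ∑-pairs-same : ∀ s x y → x ≢ y → ∑ blockLists (mult² (s , x) (s , y)) ≡ 7 * h
  ∑-pairs-same zero x y x≢y = trans (∑-blockLists _) (trans (cong₂ _+_
    (trans (∑³-cong λ _ B e → cong₂ _*_ (mult-same zero B e x) (mult-same zero B e y))
           (∑³-pairs-quad x y x≢y))
    (trans (∑³-cong λ _ B e → cong₂ _*_ (mult-opposite (suc zero) B e x) (mult-opposite (suc zero) B e y))
           (∑³-pairs-edge x y x≢y)))
    h6+h1≡7h)
  ∑-pairs-same (suc zero) x y x≢y = trans (∑-blockLists _) (trans (cong₂ _+_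
    (trans (∑³-cong λ _ B e → cong₂ _*_ (mult-opposite zero B e x) (mult-opposite zero B e y))
           (∑³-pairs-edge x y x≢y))
    (trans (∑³-cong λ _ B e → cong₂ _*_ (mult-same (suc zero) B e x) (mult-same (suc zero) B e y))
           (∑³-pairs-quad x y x≢y)))
    (trans (+-comm (h * 1) _) h6+h1≡7h))

  ∑-pairs-diff : ∀ s x y → ∑ blockLists (mult² (s , x) (opposite s , y)) ≡ 4 * q
  ∑-pairs-diff zero x y = trans (∑-blockLists _) (trans (cong₂ _+_
    (trans (∑³-cong λ _ B e → cong₂ _*_ (mult-same zero B e x) (mult-opposite zero B e y)) (∑³-mixed x y))
    (trans (∑³-cong λ _ B e → cong₂ _*_ (mult-opposite (suc zero) B e x) (mult-same (suc zero) B e y)) (∑³-mixed′ x y)))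
    2q+2q≡4q)
  ∑-pairs-diff (suc zero) x y = trans (∑-blockLists _) (trans (cong₂ _+_
    (trans (∑³-cong λ _ B e → cong₂ _*_ (mult-opposite zero B e x) (mult-same zero B e y)) (∑³-mixed′ x y))
    (trans (∑³-cong λ _ B e → cong₂ _*_ (mult-same (suc zero) B e x) (mult-opposite (suc zero) B e y)) (∑³-mixed x y)))
    2q+2q≡4q)

  side : Fin (2 * n) → Fin 2
  side i = proj₁ (from i)

  members : Fin 2 → List (Fin 2 × Point) → ℕ
  members t L = ∑ L (λ p → ⟦ proj₁ p Fin.≟ t ⟧)

  ∑-members-blockOn : ∀ s t B e → members t (blockOn s B e)
                    ≡ length B * ⟦ s Fin.≟ t ⟧ + length e * ⟦ opposite s Fin.≟ t ⟧
  ∑-members-blockOn s t B e =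
    trans (∑-++ (map (s ,_) B) _ _) (cong₂ _+_
      (trans (∑-map (s ,_) B _) (∑-const B _))
      (trans (∑-map (opposite s ,_) e _) (∑-const e _)))

  Block : Fin 2 → List (Fin 2 × Point) → Set
  Block s L = Simple 6 L × members s L ≡ 4 × members (opposite s) L ≡ 2

  blockOn-block : ∀ s {B e} → Simple 4 B → Simple 2 e → Block s (blockOn s B e)
  blockOn-block s {B} {e} (uB , lB) (ue , le) =
    ( Unique.++⁺ (Unique.map⁺ (λ { refl → refl }) uB) (Unique.map⁺ (λ { refl → refl }) ue) disjoint
    , trans (length-++ (map (s ,_) B)) (cong₂ _+_ (trans (length-map _ B) lB) (trans (length-map _ e) le)))
    , trans (∑-members-blockOn s s B e)
        (trans (cong₂ (λ u v → u * ⟦ s Fin.≟ s ⟧ + v * ⟦ opposite s Fin.≟ s ⟧) lB le) (four s))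
    , trans (∑-members-blockOn s (opposite s) B e)
        (trans (cong₂ (λ u v → u * ⟦ s Fin.≟ opposite s ⟧ + v * ⟦ opposite s Fin.≟ opposite s ⟧) lB le) (two s))
    where
    four : ∀ s → 4 * ⟦ s Fin.≟ s ⟧ + 2 * ⟦ opposite s Fin.≟ s ⟧ ≡ 4
    four zero       = refl
    four (suc zero) = refl
    two : ∀ s → 4 * ⟦ s Fin.≟ opposite s ⟧ + 2 * ⟦ opposite s Fin.≟ opposite s ⟧ ≡ 2
    two zero       = refl
    two (suc zero) = refl
    disjoint : Disjoint (map (s ,_) B) (map (opposite s ,_) e)
    disjoint (p∈B , p∈e) with ∈-map⁻ (s ,_) p∈B | ∈-map⁻ (opposite s ,_) p∈e
    ... | _ , _ , refl | _ , _ , eq = s≢opposite s (cong proj₁ eq)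

  blocksOn-blocks : ∀ s → All (Block s) (blocksOn s)
  blocksOn-blocks s = All.concat⁺ (All.map⁺ (All.universal (λ i →
      All.concat⁺ (All.map⁺ (All.map (λ {B} sB →
        All.map⁺ (All.map (blockOn-block s sB) (edges-simple i)))
      (quads-simple i))))
    classes))

  blockLists-simple : All (Simple 6) blockLists
  blockLists-simple = All.++⁺ (All.map proj₁ (blocksOn-blocks zero)) (All.map proj₁ (blocksOn-blocks (suc zero)))

  degree≡ : ∀ x → degree (map subset blockLists) x ≡ ∑ blockLists (λ L → mult _≟_ L (from x))
  degree≡ x = begin
    degree (map subset blockLists) x                      ≡⟨ length-filter (x Subset.∈?_) (map subset blockLists) ⟩
    ∑ (map subset blockLists) (λ S → ⟦ x Subset.∈? S ⟧)   ≡⟨ ∑-map subset blockLists _ ⟩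
    ∑ blockLists (λ L → ⟦ x Subset.∈? subset L ⟧)         ≡⟨ ∑-cong-All blockLists-simple (λ L (u , _) → ⟦∈?⟧-subset u x) ⟩
    ∑ blockLists (λ L → mult _≟_ L (from x))              ∎

  pairDegree≡ : ∀ x y → pairDegree (map subset blockLists) x y ≡ ∑ blockLists (mult² (from x) (from y))
  pairDegree≡ x y = begin
    pairDegree (map subset blockLists) x y
      ≡⟨ length-filter _ (map subset blockLists) ⟩
    ∑ (map subset blockLists) (λ S → bit (does (x Subset.∈? S) ∧ does (y Subset.∈? S)))
      ≡⟨ ∑-map subset blockLists _ ⟩
    ∑ blockLists (λ L → bit (does (x Subset.∈? subset L) ∧ does (y Subset.∈? subset L)))
      ≡⟨ ∑-cong-All blockLists-simple (λ L (u , _) → trans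
           (bit-∧ (does (x Subset.∈? subset L)) (does (y Subset.∈? subset L)))
           (cong₂ _*_ (⟦∈?⟧-subset u x) (⟦∈?⟧-subset u y))) ⟩
    ∑ blockLists (mult² (from x) (from y)) ∎

  ∣side∣ : ∀ s → ∣ Vec.tabulate (λ i → does (side i Fin.≟ s)) ∣ ≡ n
  ∣side∣ s = begin
    ∣ Vec.tabulate (λ i → does (side i Fin.≟ s)) ∣ ≡⟨ ∣tabulate∣ (λ i → does (side i Fin.≟ s)) ⟩
    ∑ (allFin (2 * n)) (λ i → ⟦ side i Fin.≟ s ⟧)  ≡⟨ ∑-cong (allFin (2 * n)) (λ i → lemma i) ⟨
    ∑ (allFin (2 * n)) (λ i → ⟦ from i ∈? L ⟧ * 1) ≡⟨ ∑-members unique (λ _ → 1) ⟩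
    ∑ L (λ _ → 1)                                  ≡⟨ trans (∑-const L 1) (*-identityʳ _) ⟩
    length L                                       ≡⟨ trans (length-map (s ,_) P.elements) P.length-elements ⟩
    n                                              ∎
    where
    L = map (s ,_) P.elements

    ∈-elements : ∀ x → x ∈ P.elements
    ∈-elements x = subst (_∈ P.elements) (P.from∘to x) (∈-map⁺ P.from (∈-allFin (P.to x)))

    unique : Unique L
    unique = Unique.map⁺ (λ { refl → refl }) (Unique.map⁺ (λ {i} {j} eq →
      trans (sym (P.to∘from i)) (trans (cong P.to eq) (P.to∘from j))) (Unique.allFin⁺ n))

    lemma : ∀ i → ⟦ from i ∈? L ⟧ * 1 ≡ ⟦ side i Fin.≟ s ⟧
    lemma i = trans (*-identityʳ _) (⟦⟧-⇔ (from i ∈? L) (side i Fin.≟ s) f g)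
      where
      f : from i ∈ L → side i ≡ s
      f i∈L with _ , _ , eq ← ∈-map⁻ (s ,_) i∈L = cong proj₁ eq
      g : side i ≡ s → from i ∈ L
      g refl = ∈-map⁺ (s ,_) (∈-elements (proj₂ (from i)))

  from-injective : ∀ {x y} → from x ≡ from y → x ≡ y
  from-injective {x} {y} eq = trans (sym (to∘from x)) (trans (cong to eq) (to∘from y))

  gdd : GDD n 2 6 (7 * h) (4 * q)
  gdd = record
    { groupOf     = side
    ; blocks      = map subset blockLists
    ; r           = replicationNumber
    ; group-size  = ∣side∣
    ; block-size  = All.map⁺ (All.map (λ (u , l) → trans (∣subset∣ u) l) blockLists-simple)
    ; replication = λ x → trans (degree≡ x) (∑-degree (from x))
    ; same-group  = λ x y x≢y eq → trans (pairDegree≡ x y)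
        (same (from x) (from y) (x≢y ∘ from-injective) eq)
    ; diff-group  = λ x y neq → trans (pairDegree≡ x y) (diff (from x) (from y) neq)
    }
    where
    same : ∀ p p′ → p ≢ p′ → proj₁ p ≡ proj₁ p′ → ∑ blockLists (mult² p p′) ≡ 7 * h
    same (s , x) (s , y) p≢p′ refl = ∑-pairs-same s x y (p≢p′ ∘ cong (s ,_))

    diff : ∀ p p′ → proj₁ p ≢ proj₁ p′ → ∑ blockLists (mult² p p′) ≡ 4 * q
    diff (zero     , x) (zero     , y) neq = contradiction refl neq
    diff (zero     , x) (suc zero , y) neq = ∑-pairs-diff zero x y
    diff (suc zero , x) (zero     , y) neq = ∑-pairs-diff (suc zero) x y
    diff (suc zero , x) (suc zero , y) neq = contradiction refl neq

  gdd-configuration : HasConfiguration 2 4 gdd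
  gdd-configuration = All.map⁺ (All.++⁺
    -- The first alternative of `Split` puts two points into group `zero`, so blocks with their quad
    -- on side `zero` realise the second.
    (All.map (λ ((u , _) , four , two) → inj₂ (count u zero four , count u (suc zero) two)) (blocksOn-blocks zero))
    (All.map (λ ((u , _) , four , two) → inj₁ (count u zero two , count u (suc zero) four)) (blocksOn-blocks (suc zero))))
    where
    count : ∀ {L k} → Unique L → ∀ s → members s L ≡ k →
            ∣ subset L ∩ Vec.tabulate (λ i → does (side i Fin.≟ s)) ∣ ≡ k
    count {L} u s eq = trans (∣subset∩∣ u (λ i → does (side i Fin.≟ s)))
      (trans (∑-cong L (λ p → cong (λ p′ → ⟦ proj₁ p′ Fin.≟ s ⟧) (from∘to p))) eq)

-- Developing base blocks over an abelian group of odd order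

maybe-index : ∀ {n} → A ↔ Fin n → Maybe A ↔ Fin (suc n)
maybe-index index = mk↔ₛ′
  (λ { nothing → zero ; (just x) → suc (to x) })
  (λ { zero → nothing ; (suc i) → just (from i) })
  (λ { zero → refl ; (suc i) → cong suc (strictlyInverseˡ i) })
  (λ { nothing → refl ; (just x) → cong just (strictlyInverseʳ x) })
  where open Inverse index

-- Bijectivity is recorded with its inverse g, so that the single solution of f x ≡ t in
-- `∑-permutes` is simply g t.
Permutes : (A → A) → Set _
Permutes {A = A} f = ∃ λ (g : A → A) → (∀ x → g (f x) ≡ x) × (∀ x → f (g x) ≡ x)

record OddGroup (q : ℕ) : Set₁ where
  infixl 7 _∙_ _⊖_
  infix  8 _⁻¹
  field
    Carrier         : Set
    _∙_             : Carrier → Carrier → Carrier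
    ε               : Carrier
    _⁻¹             : Carrier → Carrier
    isAbelianGroup  : IsAbelianGroup _≡_ _∙_ ε _⁻¹
    index           : Carrier ↔ Fin q
    -- For a finite abelian group this is equivalent to odd order, and it is the form in which
    -- oddness is applied.
    double-permutes : Permutes (λ x → x ∙ x)

  abelianGroup : AbelianGroup 0ℓ 0ℓ
  abelianGroup = record { isAbelianGroup = isAbelianGroup }

  open IsAbelianGroup isAbelianGroup public
    using (assoc; comm; identityˡ; identityʳ; inverseˡ; inverseʳ)
  open AbelianGroupProperties abelianGroup public
    using (⁻¹-involutive; ⁻¹-injective; ⁻¹-∙-comm; ε⁻¹≈ε; x∙y⁻¹≈ε⇒x≈y; inverseʳ-unique; ∙-cancelʳ; ∙-cancelˡ)
  open Finite index public

  _⊖_ : Carrier → Carrier → Carrier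
  x ⊖ y = x ∙ y ⁻¹

  private module CM = CommutativeMonoidSolver (AbelianGroup.commutativeMonoid abelianGroup)

  x∙[y⊖x]≡y : ∀ x y → x ∙ (y ⊖ x) ≡ y
  x∙[y⊖x]≡y x y = trans (CM.solve 3 (λ x y z → (x CM.⊕ (y CM.⊕ z)) CM.⊜ (y CM.⊕ (x CM.⊕ z))) refl x y (x ⁻¹))
    (trans (cong (y ∙_) (inverseʳ x)) (identityʳ y))

  x∙y⊖x≡y : ∀ x y → (x ∙ y) ⊖ x ≡ y
  x∙y⊖x≡y x y = trans (assoc x y (x ⁻¹)) (x∙[y⊖x]≡y x y)

  x⊖y∙y≡x : ∀ x y → (x ⊖ y) ∙ y ≡ x
  x⊖y∙y≡x x y = trans (comm _ y) (x∙[y⊖x]≡y y x)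

  x⊖x≢ : ∀ {t} → t ≢ ε → ∀ x → x ⊖ x ≢ t
  x⊖x≢ t≢ε x eq = t≢ε (trans (sym eq) (inverseʳ x))

  ⊖-≢ε : ∀ {x y} → x ≢ y → x ⊖ y ≢ ε
  ⊖-≢ε x≢y = x≢y ∘ x∙y⁻¹≈ε⇒x≈y _ _

  x⊖y≡z⊖w⇒x∙w≡z∙y : ∀ {x y z w} → x ⊖ y ≡ z ⊖ w → x ∙ w ≡ z ∙ y
  x⊖y≡z⊖w⇒x∙w≡z∙y {x} {y} {z} {w} eq = begin
    x ∙ w             ≡⟨ cong (_∙ w) (x⊖y∙y≡x x y) ⟨
    (x ⊖ y) ∙ y ∙ w   ≡⟨ cong (λ u → u ∙ y ∙ w) eq ⟩
    (z ⊖ w) ∙ y ∙ w   ≡⟨ CM.solve 4 (λ z w′ y w → ((z CM.⊕ w′) CM.⊕ y) CM.⊕ w CM.⊜ ((z CM.⊕ w′) CM.⊕ w) CM.⊕ y)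
          refl z (w ⁻¹) y w ⟩
    (z ⊖ w) ∙ w ∙ y   ≡⟨ cong (_∙ y) (x⊖y∙y≡x z w) ⟩
    z ∙ y             ∎

  x∙w≡z∙y⇒x⊖y≡z⊖w : ∀ {x y z w} → x ∙ w ≡ z ∙ y → x ⊖ y ≡ z ⊖ w
  x∙w≡z∙y⇒x⊖y≡z⊖w {x} {y} {z} {w} eq = begin
    x ⊖ y                ≡⟨ x∙y⊖x≡y w (x ⊖ y) ⟨
    (w ∙ (x ⊖ y)) ⊖ w    ≡⟨ cong (_⊖ w) (trans (sym (assoc w x (y ⁻¹))) (cong (_⊖ y) (trans (comm w x) (trans eq (comm z y))))) ⟩
    ((y ∙ z) ⊖ y) ⊖ w    ≡⟨ cong (_⊖ w) (x∙y⊖x≡y y z) ⟩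
    z ⊖ w                ∎

  ∑-permutes : ∀ {f : Carrier → Carrier} → Permutes f → ∀ t → ∑ elements (λ x → ⟦ f x ≟ t ⟧) ≡ 1
  ∑-permutes {f} (g , gf , fg) t = trans
    (∑-cong elements (λ x → ⟦⟧-⇔ (f x ≟ t) (x ≟ g t) (λ { refl → sym (gf x) }) (λ { refl → fg t })))
    (∑-δ₁ (g t))

  ∑-∘⁻¹ : (f : Carrier → ℕ) → ∑ elements (f ∘ _⁻¹) ≡ ∑ elements f
  ∑-∘⁻¹ f = begin
    ∑ elements (λ x → f (x ⁻¹))
      ≡⟨ ∑-cong elements (λ x → sym (∑-δ (x ⁻¹) f)) ⟩
    ∑ elements (λ x → ∑ elements (λ y → ⟦ y ≟ x ⁻¹ ⟧ * f y))
      ≡⟨ ∑-swap elements elements _ ⟩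
    ∑ elements (λ y → ∑ elements (λ x → ⟦ y ≟ x ⁻¹ ⟧ * f y))
      ≡⟨ ∑-cong elements (λ y → trans (∑-*ʳ elements (f y) _) (cong (_* f y) (trans
           (∑-cong elements (λ x → ⟦⟧-⇔ (y ≟ x ⁻¹) (x ≟ y ⁻¹)
              (λ { refl → sym (⁻¹-involutive x) }) (λ { refl → sym (⁻¹-involutive y) })))
           (∑-δ₁ (y ⁻¹))))) ⟩
    ∑ elements (λ y → 1 * f y)
      ≡⟨ ∑-cong elements (λ y → *-identityˡ (f y)) ⟩
    ∑ elements f ∎

  double-injective : ∀ {x y} → x ∙ x ≡ y ∙ y → x ≡ y
  double-injective {x} {y} eq with g , gf , _ ← double-permutes =
    trans (sym (gf x)) (trans (cong g eq) (gf y))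

  x≢x⁻¹ : ∀ {x} → x ≢ ε → x ≢ x ⁻¹
  x≢x⁻¹ {x} x≢ε eq = x≢ε (double-injective (begin
    x ∙ x  ≡⟨ cong (x ∙_) eq ⟩
    x ⊖ x  ≡⟨ inverseʳ x ⟩
    ε      ≡⟨ identityˡ ε ⟨
    ε ∙ ε  ∎))

  -- The diagonal pairs are included. They have difference ε, so for t ≢ ε this is the multiplicity
  -- of t in the usual list of differences of B.
  Δ : Carrier → List Carrier → ℕ
  Δ t B = ∑ B λ x → ∑ B λ y → ⟦ x ⊖ y ≟ t ⟧

  translate : Carrier → List Carrier → List Carrier
  translate g = map (_∙ g)

  _#_ : Carrier → List Carrier → ℕ
  x # L = mult _≟_ L x

  #-translate : ∀ g B x → x # translate g B ≡ ∑ B (λ a → ⟦ g ≟ x ⊖ a ⟧)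
  #-translate g B x = trans (∑-map (_∙ g) B _) (∑-cong B λ a → ⟦⟧-⇔ (a ∙ g ≟ x) (g ≟ x ⊖ a)
    (λ { refl → sym (x∙y⊖x≡y a g) }) (λ { refl → x∙[y⊖x]≡y a x }))

  ∑-#-translate : ∀ B x → ∑ elements (λ g → x # translate g B) ≡ length B
  ∑-#-translate B x = begin
    ∑ elements (λ g → x # translate g B)             ≡⟨ ∑-cong elements (λ g → #-translate g B x) ⟩
    ∑ elements (λ g → ∑ B (λ a → ⟦ g ≟ x ⊖ a ⟧))     ≡⟨ ∑-swap elements B _ ⟩
    ∑ B (λ a → ∑ elements (λ g → ⟦ g ≟ x ⊖ a ⟧))     ≡⟨ ∑-cong B (λ a → ∑-δ₁ (x ⊖ a)) ⟩
    ∑ B (λ _ → 1)                                    ≡⟨ ∑-const B 1 ⟩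
    length B * 1                                     ≡⟨ *-identityʳ _ ⟩
    length B                                         ∎

  -- The translate by g contains x as the image of a and y as the image of b exactly when g equals
  -- both x ⊖ a and y ⊖ b. Such a g exists if and only if a ⊖ b ≡ x ⊖ y, and it is then unique.
  ∑-##-translate : ∀ B x y → ∑ elements (λ g → x # translate g B * y # translate g B) ≡ Δ (x ⊖ y) B
  ∑-##-translate B x y = begin
    ∑ elements (λ g → x # translate g B * y # translate g B)
      ≡⟨ ∑-cong elements (λ g → trans (cong₂ _*_ (#-translate g B x) (#-translate g B y)) (∑-product B B _ _)) ⟩
    ∑ elements (λ g → ∑ B λ a → ∑ B λ b → ⟦ g ≟ x ⊖ a ⟧ * ⟦ g ≟ y ⊖ b ⟧)
      ≡⟨ ∑-swap elements B _ ⟩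
    (∑ B λ a → ∑ elements λ g → ∑ B λ b → ⟦ g ≟ x ⊖ a ⟧ * ⟦ g ≟ y ⊖ b ⟧)
      ≡⟨ ∑-cong B (λ a → ∑-swap elements B _) ⟩
    (∑ B λ a → ∑ B λ b → ∑ elements λ g → ⟦ g ≟ x ⊖ a ⟧ * ⟦ g ≟ y ⊖ b ⟧)
      ≡⟨ ∑-cong B (λ a → ∑-cong B (λ b → trans (∑-δ (x ⊖ a) (λ g → ⟦ g ≟ y ⊖ b ⟧))
           (⟦⟧-⇔ (x ⊖ a ≟ y ⊖ b) (a ⊖ b ≟ x ⊖ y) swap swap⁻¹))) ⟩
    Δ (x ⊖ y) B ∎
    where
    swap : ∀ {a b} → x ⊖ a ≡ y ⊖ b → a ⊖ b ≡ x ⊖ y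
    swap {a} {b} eq = x∙w≡z∙y⇒x⊖y≡z⊖w (trans (comm a y) (sym (x⊖y≡z⊖w⇒x∙w≡z∙y eq)))
    swap⁻¹ : ∀ {a b} → a ⊖ b ≡ x ⊖ y → x ⊖ a ≡ y ⊖ b
    swap⁻¹ {a} {b} eq = x∙w≡z∙y⇒x⊖y≡z⊖w (trans (sym (x⊖y≡z⊖w⇒x∙w≡z∙y eq)) (comm a y))

-- Half systems: one element from each pair {d, d⁻¹}

record HalfSystem {q : ℕ} (G : OddGroup q) : Set where
  open OddGroup G
  field
    half       : List Carrier
    half-≢ε    : All (_≢ ε) half
    -- That ε, `half` and the inverses of `half` exhaust G without repetition is stated through
    -- arbitrary sums, because it only ever serves to complete a sum over `half` to one over G.
    ∑-half     : ∀ f → f ε + ∑ half (λ d → f d + f (d ⁻¹)) ≡ ∑ elements f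

  q≡1+2∣half∣ : q ≡ 1 + length half * 2
  q≡1+2∣half∣ = begin
    q                       ≡⟨ length-elements ⟨
    length elements         ≡⟨ *-identityʳ _ ⟨
    length elements * 1     ≡⟨ ∑-const elements 1 ⟨
    ∑ elements (λ _ → 1)    ≡⟨ ∑-half (λ _ → 1) ⟨
    1 + ∑ half (λ _ → 2)    ≡⟨ cong suc (∑-const half 2) ⟩
    1 + length half * 2     ∎

-- From each pair {x, x⁻¹} the element with the smaller index is chosen.
halfSystem : ∀ {q} (G : OddGroup q) → HalfSystem G
halfSystem G = record
  { half    = filter positive? elements
  ; half-≢ε = All.map (λ { p refl → Fin.<-irrefl (cong to (sym ε⁻¹≈ε)) p }) (All.all-filter positive? elements)
  ; ∑-half  = sum-half
  }
  where
  open OddGroup G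
  positive? : ∀ x → _
  positive? x = to x Fin.<? to (x ⁻¹)

  pos : Carrier → ℕ
  pos x = ⟦ positive? x ⟧

  trichotomy : ∀ x → ⟦ x ≟ ε ⟧ + (pos x + pos (x ⁻¹)) ≡ 1
  trichotomy x with Fin.<-cmp (to x) (to (x ⁻¹))
  ... | tri< lt x≢ gt = cong₂ _+_ (⟦⟧-no (x ≟ ε) λ { refl → x≢ (cong to (sym ε⁻¹≈ε)) })
    (cong₂ _+_ (⟦⟧-yes (positive? x) lt)
               (⟦⟧-no (positive? (x ⁻¹)) (gt ∘ subst (λ y → to (x ⁻¹) Fin.< to y) (⁻¹-involutive x))))
  ... | tri> lt x≢ gt = cong₂ _+_ (⟦⟧-no (x ≟ ε) λ { refl → x≢ (cong to (sym ε⁻¹≈ε)) })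
    (cong₂ _+_ (⟦⟧-no (positive? x) lt)
               (⟦⟧-yes (positive? (x ⁻¹)) (subst (λ y → to (x ⁻¹) Fin.< to y) (sym (⁻¹-involutive x)) gt)))
  -- Equal indices mean x ≡ x⁻¹, which odd order allows only for x ≡ ε.
  ... | tri≈ lt eq gt = cong₂ _+_ (⟦⟧-yes (x ≟ ε) x≡ε)
    (cong₂ _+_ (⟦⟧-no (positive? x) lt)
               (⟦⟧-no (positive? (x ⁻¹)) (gt ∘ subst (λ y → to (x ⁻¹) Fin.< to y) (⁻¹-involutive x))))
    where
    x≡ε : x ≡ ε
    x≡ε with x ≟ ε
    ... | yes x≡ε = x≡ε
    ... | no  x≢ε = contradiction (trans (sym (from∘to x)) (trans (cong from eq) (from∘to (x ⁻¹)))) (x≢x⁻¹ x≢ε)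

  sum-half : ∀ f → f ε + ∑ (filter positive? elements) (λ d → f d + f (d ⁻¹)) ≡ ∑ elements f
  sum-half f = begin
    f ε + ∑ (filter positive? elements) (λ d → f d + f (d ⁻¹))
      ≡⟨ cong (f ε +_) (∑-filter positive? elements _) ⟩
    f ε + ∑ elements (λ d → pos d * (f d + f (d ⁻¹)))
      ≡⟨ cong (f ε +_) (trans (∑-cong elements λ d → *-distribˡ-+ (pos d) (f d) (f (d ⁻¹))) (∑-+ elements _ _)) ⟩
    f ε + (∑ elements (λ d → pos d * f d) + ∑ elements (λ d → pos d * f (d ⁻¹)))
      -- Substituting d⁻¹ for d in the second sum makes f d a common factor, whose coefficient is
      -- then 1 by `trichotomy`.
      ≡⟨ cong (λ u → f ε + (∑ elements (λ d → pos d * f d) + u)) (trans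
           (∑-cong elements λ d → cong (λ e → pos e * f (d ⁻¹)) (sym (⁻¹-involutive d)))
           (∑-∘⁻¹ (λ d → pos (d ⁻¹) * f d))) ⟩
    f ε + (∑ elements (λ d → pos d * f d) + ∑ elements (λ d → pos (d ⁻¹) * f d))
      ≡⟨ cong₂ _+_ (∑-δ ε f) (∑-+ elements _ _) ⟨
    ∑ elements (λ d → ⟦ d ≟ ε ⟧ * f d) + ∑ elements (λ d → pos d * f d + pos (d ⁻¹) * f d)
      ≡⟨ ∑-+ elements _ _ ⟨
    ∑ elements (λ d → ⟦ d ≟ ε ⟧ * f d + (pos d * f d + pos (d ⁻¹) * f d))
      ≡⟨ ∑-cong elements (λ d → begin
           ⟦ d ≟ ε ⟧ * f d + (pos d * f d + pos (d ⁻¹) * f d) ≡⟨ cong (⟦ d ≟ ε ⟧ * f d +_) (*-distribʳ-+ (f d) (pos d) _) ⟨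
           ⟦ d ≟ ε ⟧ * f d + (pos d + pos (d ⁻¹)) * f d       ≡⟨ *-distribʳ-+ (f d) ⟦ d ≟ ε ⟧ _ ⟨
           (⟦ d ≟ ε ⟧ + (pos d + pos (d ⁻¹))) * f d           ≡⟨ cong (_* f d) (trichotomy d) ⟩
           1 * f d                                            ≡⟨ *-identityˡ (f d) ⟩
           f d                                                ∎) ⟩
    ∑ elements f ∎

-- Base blocks on G ∪ {∞}; a list in `punctured` stands for the block obtained by
-- adding ∞ to it.
record OneRotational {q : ℕ} (G : OddGroup q) (k μ : ℕ) : Set where
  open OddGroup G
  field
    full punctured   : List (List Carrier)
    full-simple      : All (Simple (suc k)) full
    punctured-simple : All (Simple k) punctured
    infinite-pairs   : length punctured * k ≡ μ
    differences      : ∀ t → t ≢ ε → ∑ (full ++ punctured) (Δ t) ≡ μ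

  private module M = Finite (maybe-index index)

  infix 20 _##_
  _##_ : Maybe Carrier → List (Maybe Carrier) → ℕ
  x ## L = mult M._≟_ L x

  fullAt puncturedAt : Carrier → List Carrier → List (Maybe Carrier)
  fullAt      g B = map just (translate g B)
  puncturedAt g B = nothing ∷ fullAt g B

  blocksAt : Carrier → List (List (Maybe Carrier))
  blocksAt g = map (fullAt g) full ++ map (puncturedAt g) punctured

  length-blocksAt : ∀ g → length (blocksAt g) ≡ length full + length punctured
  length-blocksAt g = trans (length-++ (map (fullAt g) full))
    (cong₂ _+_ (length-map (fullAt g) full) (length-map (puncturedAt g) punctured))

  blocksAt-simple : ∀ g → All (Simple (suc k)) (blocksAt g)
  blocksAt-simple g = All.++⁺
    (All.map⁺ (All.map (λ {B} → fullAt-simple {B}) full-simple))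
    (All.map⁺ (All.map (λ {B} sB → let (u , l) = fullAt-simple {B} sB in
      All.map⁺ (All.universal (λ _ ()) (translate g B)) ∷ u , cong suc l) punctured-simple))
    where
    fullAt-simple : ∀ {B j} → Simple j B → Simple j (fullAt g B)
    fullAt-simple {B} (u , l) =
      Unique.map⁺ just-injective (Unique.map⁺ (λ {x} {y} → ∙-cancelʳ g x y) u)
      , trans (length-map just (translate g B)) (trans (length-map (_∙ g) B) l)

  just-fullAt : ∀ x g B → just x ## fullAt g B ≡ x # translate g B
  just-fullAt x g B = mult-map _≟_ M._≟_ just just-injective (translate g B) x

  nothing-fullAt : ∀ g B → nothing ## fullAt g B ≡ 0
  nothing-fullAt g B = mult-map-∉ M._≟_ just (translate g B) (λ _ ())

  just-puncturedAt : ∀ x g B → just x ## puncturedAt g B ≡ x # translate g B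
  just-puncturedAt = just-fullAt

  nothing-puncturedAt : ∀ g B → nothing ## puncturedAt g B ≡ 1
  nothing-puncturedAt g B = cong suc (nothing-fullAt g B)

  ∑-blocksAt : ∀ g (f : List (Maybe Carrier) → ℕ) →
               ∑ (blocksAt g) f ≡ ∑ full (f ∘ fullAt g) + ∑ punctured (f ∘ puncturedAt g)
  ∑-blocksAt g f = trans (∑-++ (map (fullAt g) full) _ f)
    (cong₂ _+_ (∑-map (fullAt g) full f) (∑-map (puncturedAt g) punctured f))

  ∑-blocksAt-cong : ∀ {g f} {u v : List Carrier → ℕ} → (∀ B → f (fullAt g B) ≡ u B) →
                    (∀ B → f (puncturedAt g B) ≡ v B) → ∑ (blocksAt g) f ≡ ∑ full u + ∑ punctured v
  ∑-blocksAt-cong {g} {f} equ eqv =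
    trans (∑-blocksAt g f) (cong₂ _+_ (∑-cong full equ) (∑-cong punctured eqv))

  ∑-development : ∀ {f} {u v : Carrier → List Carrier → ℕ} →
    (∀ g B → f (fullAt g B) ≡ u g B) → (∀ g B → f (puncturedAt g B) ≡ v g B) →
    ∑ elements (λ g → ∑ (blocksAt g) f)
    ≡ ∑ full (λ B → ∑ elements (λ g → u g B)) + ∑ punctured (λ B → ∑ elements (λ g → v g B))
  ∑-development equ eqv = trans
    (∑-cong elements (λ g → ∑-blocksAt-cong (equ g) (eqv g)))
    (trans (∑-+ elements _ _) (cong₂ _+_ (∑-swap elements full _) (∑-swap elements punctured _)))

  ∑-length-punctured : ∑ punctured length ≡ μ
  ∑-length-punctured = trans (∑-cong-All punctured-simple (λ _ → proj₂))
    (trans (∑-const punctured k) infinite-pairs)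

  degree-just : ∀ x → ∑ elements (λ g → ∑ (blocksAt g) (just x ##_)) ≡ length full * suc k + μ
  degree-just x = trans (∑-development (just-fullAt x) (just-puncturedAt x)) (cong₂ _+_
    (trans (∑-cong full (λ B → ∑-#-translate B x))
      (trans (∑-cong-All full-simple (λ _ → proj₂)) (∑-const full (suc k))))
    (trans (∑-cong punctured (λ B → ∑-#-translate B x)) ∑-length-punctured))

  degree-nothing : ∑ elements (λ g → ∑ (blocksAt g) (nothing ##_)) ≡ length punctured * q
  degree-nothing = trans (∑-development nothing-fullAt nothing-puncturedAt) (cong₂ _+_
    (trans (∑-cong full (λ _ → ∑-zero elements)) (∑-zero full))
    (trans (∑-const punctured _) (cong (length punctured *_)
      (trans (∑-const elements 1) (trans (*-identityʳ _) length-elements)))))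

  -- Translation fixes ∞, so only the punctured blocks count; each of them contains x in as many
  -- translates as it has elements, namely k.
  pairs-mixed : ∀ x → ∑ elements (λ g → ∑ (blocksAt g) λ L → just x ## L * nothing ## L) ≡ μ
  pairs-mixed x = trans (∑-development
      (λ g B → trans (cong (just x ## fullAt g B *_) (nothing-fullAt g B)) (*-zeroʳ (just x ## fullAt g B)))
      (λ g B → trans (cong₂ _*_ (just-puncturedAt x g B) (nothing-puncturedAt g B)) (*-identityʳ _)))
    (cong₂ _+_
      (trans (∑-cong full (λ _ → ∑-zero elements)) (∑-zero full))
      (trans (∑-cong punctured (λ B → ∑-#-translate B x)) ∑-length-punctured))

  pairs : ∀ x y → x ≢ y → ∑ elements (λ g → ∑ (blocksAt g) λ L → x ## L * y ## L) ≡ μ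
  pairs nothing  nothing  x≢y = contradiction refl x≢y
  pairs (just x) nothing  x≢y = pairs-mixed x
  pairs nothing  (just y) x≢y = trans
    (∑-cong elements λ g → ∑-cong (blocksAt g) λ L → *-comm (nothing ## L) (just y ## L)) (pairs-mixed y)
  pairs (just x) (just y) x≢y = begin
    ∑ elements (λ g → ∑ (blocksAt g) λ L → just x ## L * just y ## L)
      ≡⟨ ∑-development (λ g B → cong₂ _*_ (just-fullAt x g B) (just-fullAt y g B))
                       (λ g B → cong₂ _*_ (just-puncturedAt x g B) (just-puncturedAt y g B)) ⟩
    _ ≡⟨ cong₂ _+_ (∑-cong full λ B → ∑-##-translate B x y) (∑-cong punctured λ B → ∑-##-translate B x y) ⟩
    ∑ full (Δ (x ⊖ y)) + ∑ punctured (Δ (x ⊖ y))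
      ≡⟨ ∑-++ full punctured _ ⟨
    ∑ (full ++ punctured) (Δ (x ⊖ y))
      ≡⟨ differences (x ⊖ y) (⊖-≢ε (x≢y ∘ cong just)) ⟩
    μ ∎

  -- This makes each translate of the patterned starter a one-factor: x lies in the translate by g
  -- of a base block exactly when x ⊖ g lies in the block, and ∞ lies in the translate of the only
  -- punctured block.
  resolved : length punctured ≡ 1 → (∀ x → ∑ (full ++ punctured) (x #_) ≡ 1) →
             ∀ g x → ∑ (blocksAt g) (x ##_) ≡ 1
  resolved one _ g nothing = trans (∑-blocksAt-cong (nothing-fullAt g) (nothing-puncturedAt g))
    (cong₂ _+_ (∑-zero full) (trans (∑-const punctured 1) (trans (*-identityʳ _) one)))
  resolved one partition g (just x) = begin
    ∑ (blocksAt g) (just x ##_)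
      ≡⟨ ∑-blocksAt-cong (just-fullAt x g) (just-puncturedAt x g) ⟩
    _ ≡⟨ ∑-++ full punctured _ ⟨
    ∑ (full ++ punctured) (λ B → x # translate g B)
      ≡⟨ ∑-cong (full ++ punctured) (λ B → trans (∑-map (_∙ g) B _) (∑-cong B (λ a →
           ⟦⟧-⇔ (a ∙ g ≟ x) (a ≟ x ⊖ g)
             (λ { refl → sym (trans (cong (_⊖ g) (comm a g)) (x∙y⊖x≡y g a)) })
             (λ { refl → x⊖y∙y≡x x g })))) ⟩
    ∑ (full ++ punctured) ((x ⊖ g) #_)
      ≡⟨ partition (x ⊖ g) ⟩
    1 ∎

-- The size condition matches the blocks through a translate with the edges of a one-factor.
QuadDesign : ∀ {q} → OddGroup q → Set
QuadDesign G = Σ (OneRotational G 3 6) λ D →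
  length (OneRotational.full D) + 1 ≡ length (HalfSystem.half (halfSystem G))

-- The one-factorization and the factored design

module _ {q : ℕ} (G : OddGroup q) where
  open OddGroup G
  open HalfSystem (halfSystem G)

  -- The patterned starter, which develops into the one-factorization GK of the
  -- complete graph.
  patterned : OneRotational G 1 1
  patterned = record
    { full             = map (λ d → d ∷ d ⁻¹ ∷ []) half
    ; punctured        = (ε ∷ []) ∷ []
    ; full-simple      = All.map⁺ (All.map (λ d≢ε → ((x≢x⁻¹ d≢ε ∷ []) ∷ [] ∷ []) , refl) half-≢ε)
    ; punctured-simple = (([] ∷ []) , refl) ∷ []
    ; infinite-pairs   = refl
    ; differences      = diffs
    }
    where
    diffs : ∀ t → t ≢ ε → _ ≡ 1
    diffs t t≢ε = begin
      ∑ (map (λ d → d ∷ d ⁻¹ ∷ []) half ++ (ε ∷ []) ∷ []) (Δ t)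
        ≡⟨ ∑-++ (map (λ d → d ∷ d ⁻¹ ∷ []) half) _ (Δ t) ⟩
      ∑ (map (λ d → d ∷ d ⁻¹ ∷ []) half) (Δ t) + (Δ t (ε ∷ []) + 0)
        ≡⟨ cong₂ _+_ (trans (∑-map _ half (Δ t)) (∑-cong half pair))
             (trans (+-identityʳ _) (trans (+-identityʳ _) (trans (+-identityʳ _) (zero-diff ε)))) ⟩
      ∑ half (λ d → φ d + φ (d ⁻¹)) + 0
        -- The term φ ε is zero because ε ∙ ε ≡ ε ≢ t; adding it completes the sum over `half` to a
        -- sum over G.
        ≡⟨ trans (+-identityʳ _) (cong (_+ ∑ half (λ d → φ d + φ (d ⁻¹))) (sym (⟦⟧-no (ε ∙ ε ≟ t) (λ eq → t≢ε (trans (sym eq) (identityˡ ε)))))) ⟩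
      φ ε + ∑ half (λ d → φ d + φ (d ⁻¹))
        ≡⟨ ∑-half φ ⟩
      ∑ elements φ
        ≡⟨ ∑-permutes double-permutes t ⟩
      1 ∎
      where
      φ : Carrier → ℕ
      φ d = ⟦ d ∙ d ≟ t ⟧
      zero-diff : ∀ d → ⟦ d ⊖ d ≟ t ⟧ ≡ 0
      zero-diff d = ⟦⟧-no (d ⊖ d ≟ t) (x⊖x≢ t≢ε d)
      pair : ∀ d → Δ t (d ∷ d ⁻¹ ∷ []) ≡ φ d + φ (d ⁻¹)
      pair d rewrite zero-diff d | zero-diff (d ⁻¹) | ⁻¹-involutive d =
        cong₂ _+_ (+-identityʳ (φ d)) (trans (+-identityʳ (φ (d ⁻¹) + 0)) (+-identityʳ (φ (d ⁻¹))))

  patterned-partition : ∀ x → ∑ (OneRotational.full patterned ++ OneRotational.punctured patterned) (x #_) ≡ 1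
  patterned-partition x = begin
    ∑ (map (λ d → d ∷ d ⁻¹ ∷ []) half ++ (ε ∷ []) ∷ []) (x #_)
      ≡⟨ ∑-++ (map (λ d → d ∷ d ⁻¹ ∷ []) half) _ (x #_) ⟩
    ∑ (map (λ d → d ∷ d ⁻¹ ∷ []) half) (x #_) + (⟦ ε ≟ x ⟧ + 0 + 0)
      ≡⟨ cong₂ _+_ (trans (∑-map _ half (x #_)) (∑-cong half (λ d → cong (⟦ d ≟ x ⟧ +_) (+-identityʳ _))))
                   (trans (+-identityʳ _) (+-identityʳ _)) ⟩
    ∑ half (λ d → ⟦ d ≟ x ⟧ + ⟦ d ⁻¹ ≟ x ⟧) + ⟦ ε ≟ x ⟧
      ≡⟨ +-comm _ ⟦ ε ≟ x ⟧ ⟩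
    ⟦ ε ≟ x ⟧ + ∑ half (λ d → ⟦ d ≟ x ⟧ + ⟦ d ⁻¹ ≟ x ⟧)
      ≡⟨ ∑-half (λ d → ⟦ d ≟ x ⟧) ⟩
    ∑ elements (λ d → ⟦ d ≟ x ⟧)
      ≡⟨ ∑-δ₁ x ⟩
    1 ∎

  factoredDesign : QuadDesign G → FactoredDesign (suc q) (suc (length half)) q
  factoredDesign (D , size) = record
    { index        = maybe-index index
    ; classes      = elements
    ; quads        = D.blocksAt
    ; edges        = E.blocksAt
    ; length-quads = λ g → trans (D.length-blocksAt g) (trans (cong (length D.full +_) two) (trans
        (sym (+-assoc (length D.full) 1 1)) (trans (+-comm _ 1) (cong suc size))))
    ; length-edges = λ g → trans (E.length-blocksAt g) (trans (+-comm _ 1) (cong suc (length-map _ half)))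
    ; quads-simple = D.blocksAt-simple
    ; edges-simple = E.blocksAt-simple
    ; quad-degree  = λ { (just x) → trans (D.degree-just x) finite ; nothing → trans D.degree-nothing (cong (_* q) two) }
    ; edge-degree  = E.resolved refl patterned-partition
    ; quad-pairs   = D.pairs
    ; edge-pairs   = E.pairs
    }
    where
    module D = OneRotational D
    module E = OneRotational patterned
    two : length D.punctured ≡ 2
    two = *-cancelʳ-≡ (length D.punctured) 2 3 D.infinite-pairs

    -- A finite point must have the same degree 2q as ∞. This is where the size condition enters: f
    -- full blocks give degree 4f + 6, and f + 1 is (q - 1)/2.
    finite : length D.full * 4 + 6 ≡ 2 * q
    finite = begin
      length D.full * 4 + 6                 ≡⟨ solve 1 (λ f → f :* con 4 :+ con 6 := con 2 :* (con 1 :+ (f :+ con 1) :* con 2)) refl (length D.full) ⟩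
      2 * (1 + (length D.full + 1) * 2)     ≡⟨ cong (λ u → 2 * (1 + u * 2)) size ⟩
      2 * (1 + length half * 2)             ≡⟨ cong (2 *_) q≡1+2∣half∣ ⟨
      2 * q                                 ∎
      where open +-*-Solver using (solve; _:+_; _:*_; _:=_; con)

-- Automorphisms α with 1 + α and 1 - α bijective

record SplittingAutomorphism {q : ℕ} (G : OddGroup q) : Set where
  open OddGroup G
  field
    α             : Carrier → Carrier
    α-homo        : ∀ x y → α (x ∙ y) ≡ α x ∙ α y
    α-permutes    : Permutes α
    id+α-permutes : Permutes (λ x → x ∙ α x)
    id-α-permutes : Permutes (λ x → x ⊖ α x)

  α-ε : α ε ≡ ε
  α-ε = ∙-cancelˡ (α ε) (α ε) ε (trans (sym (α-homo ε ε)) (trans (cong α (identityˡ ε)) (sym (identityʳ (α ε)))))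

  α-⁻¹ : ∀ x → α (x ⁻¹) ≡ α x ⁻¹
  α-⁻¹ x = inverseʳ-unique (α x) (α (x ⁻¹)) (trans (sym (α-homo x (x ⁻¹))) (trans (cong α (inverseʳ x)) α-ε))

  -- Coincidences inside a quad say that a bijection fixing ε sends some x ≢ ε to ε: x ≡ α x
  -- contradicts `id-α-permutes`, x ≡ α x ⁻¹ contradicts `id+α-permutes`, and α x ≡ α x ⁻¹ would
  -- force α x ≡ ε.
  permutes-≢ε : ∀ {f : Carrier → Carrier} → Permutes f → f ε ≡ ε → ∀ {x} → x ≢ ε → f x ≢ ε
  permutes-≢ε (g , gf , _) fε {x} x≢ε fx≡ε =
    x≢ε (trans (sym (gf x)) (trans (cong g (trans fx≡ε (sym fε))) (gf ε)))

  module _ {x} (x≢ε : x ≢ ε) where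

    αx≢ε : α x ≢ ε
    αx≢ε = permutes-≢ε α-permutes α-ε x≢ε

    x≢αx : x ≢ α x
    x≢αx eq = permutes-≢ε id-α-permutes (trans (cong (ε ⊖_) α-ε) (inverseʳ ε)) x≢ε
      (trans (cong (_⊖ α x) eq) (inverseʳ (α x)))

    x∙αx≢ε : x ∙ α x ≢ ε
    x∙αx≢ε = permutes-≢ε id+α-permutes (trans (cong (ε ∙_) α-ε) (identityˡ ε)) x≢ε

    x≢αx⁻¹ : x ≢ α x ⁻¹
    x≢αx⁻¹ eq = x∙αx≢ε (trans (cong (_∙ α x) eq) (inverseˡ (α x)))

    x⁻¹≢αx : x ⁻¹ ≢ α x
    x⁻¹≢αx eq = x∙αx≢ε (trans (cong (x ∙_) (sym eq)) (inverseʳ x))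

    x⁻¹≢αx⁻¹ : x ⁻¹ ≢ α x ⁻¹
    x⁻¹≢αx⁻¹ eq = x≢αx (⁻¹-injective eq)

    quad-unique : Unique (x ∷ x ⁻¹ ∷ α x ∷ α x ⁻¹ ∷ [])
    quad-unique = (x≢x⁻¹ x≢ε ∷ x≢αx ∷ x≢αx⁻¹ ∷ []) ∷ (x⁻¹≢αx ∷ x⁻¹≢αx⁻¹ ∷ [])
                ∷ (x≢x⁻¹ αx≢ε ∷ []) ∷ [] ∷ []

  -- The differences of {x, x⁻¹, α x, (α x)⁻¹}: x ∙ x and α x ∙ α x once,
  -- x ∙ α x and x ⊖ α x twice, each together with its inverse.
  module _ (t : Carrier) where

    z : ℕ
    z = ⟦ ε ≟ t ⟧

    S Sα D₋ D₊ : Carrier → ℕ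
    S x = ⟦ x ∙ x ≟ t ⟧
    Sα x = ⟦ α x ∙ α x ≟ t ⟧
    D₋ x = ⟦ x ⊖ α x ≟ t ⟧
    D₊ x = ⟦ x ∙ α x ≟ t ⟧

    S-ε : S ε ≡ z
    S-ε = cong (λ u → ⟦ u ≟ t ⟧) (identityˡ ε)

    Sα-ε : Sα ε ≡ z
    Sα-ε = trans (cong (λ u → ⟦ u ∙ u ≟ t ⟧) α-ε) S-ε

    D₋-ε : D₋ ε ≡ z
    D₋-ε = cong (λ u → ⟦ u ≟ t ⟧) (trans (cong (ε ⊖_) α-ε) (inverseʳ ε))

    D₊-ε : D₊ ε ≡ z
    D₊-ε = trans (cong (λ u → ⟦ ε ∙ u ≟ t ⟧) α-ε) S-ε

    ∑S : ∑ elements S ≡ 1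
    ∑S = ∑-permutes double-permutes t

    ∑Sα : ∑ elements Sα ≡ 1
    ∑Sα with g , gf , fg ← double-permutes | a , aα , αa ← α-permutes =
      ∑-permutes ((λ x → a (g x)) , (λ x → trans (cong a (gf (α x))) (aα x))
                 , (λ x → trans (cong (λ y → y ∙ y) (αa (g x))) (fg x))) t

    ∑D₋ : ∑ elements D₋ ≡ 1
    ∑D₋ = ∑-permutes id-α-permutes t

    ∑D₊ : ∑ elements D₊ ≡ 1
    ∑D₊ = ∑-permutes id+α-permutes t

    module _ (x : Carrier) where
      open +-*-Solver using (solve; _:+_; _:*_; _:=_; con)

      Δ-triple₁ : Δ t (x ∷ x ⁻¹ ∷ α x ∷ []) ≡ 3 * z + (D₋ x + D₋ (x ⁻¹) + (D₊ x + D₊ (x ⁻¹)) + (S x + S (x ⁻¹)))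
      -- The rewrites normalise all nine differences. Afterwards `D₋ (x ⁻¹)` reads
      -- `⟦ x ⁻¹ ∙ α x ≟ t ⟧` and `D₊ (x ⁻¹)` reads `⟦ x ⁻¹ ∙ α x ⁻¹ ≟ t ⟧`, so that a linear
      -- identity in ℕ is left.
      Δ-triple₁ rewrite α-⁻¹ x | ⁻¹-involutive x | ⁻¹-involutive (α x) | inverseʳ x | inverseˡ x
                      | inverseʳ (α x) | comm (α x) (x ⁻¹) | comm (α x) x =
        solve 7 (λ z S S′ D₋ D₋′ D₊ D₊′ →
            (z :+ (S :+ (D₋ :+ con 0))) :+ ((S′ :+ (z :+ (D₊′ :+ con 0))) :+ ((D₋′ :+ (D₊ :+ (z :+ con 0))) :+ con 0))
            := con 3 :* z :+ (D₋ :+ D₋′ :+ (D₊ :+ D₊′) :+ (S :+ S′)))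
          refl z (S x) (S (x ⁻¹)) (D₋ x) ⟦ x ⁻¹ ∙ α x ≟ t ⟧ (D₊ x) ⟦ x ⁻¹ ∙ α x ⁻¹ ≟ t ⟧

      Δ-triple₂ : Δ t (x ∷ α x ∷ α x ⁻¹ ∷ []) ≡ 3 * z + (D₋ x + D₋ (x ⁻¹) + (D₊ x + D₊ (x ⁻¹)) + (Sα x + Sα (x ⁻¹)))
      Δ-triple₂ rewrite α-⁻¹ x | ⁻¹-involutive (α x) | inverseʳ x | inverseˡ (α x)
                      | inverseʳ (α x) | comm (α x) (x ⁻¹) | comm (α x ⁻¹) (x ⁻¹) =
        solve 7 (λ z Sα Sα′ D₋ D₋′ D₊ D₊′ →
            (z :+ (D₋ :+ (D₊ :+ con 0))) :+ ((D₋′ :+ (z :+ (Sα :+ con 0))) :+ ((D₊′ :+ (Sα′ :+ (z :+ con 0))) :+ con 0))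
            := con 3 :* z :+ (D₋ :+ D₋′ :+ (D₊ :+ D₊′) :+ (Sα :+ Sα′)))
          refl z (Sα x) ⟦ α x ⁻¹ ∙ α x ⁻¹ ≟ t ⟧ (D₋ x) ⟦ x ⁻¹ ∙ α x ≟ t ⟧ (D₊ x) ⟦ x ⁻¹ ∙ α x ⁻¹ ≟ t ⟧

      -- The weights distinguish differences inside {x, x⁻¹} and {α x, (α x)⁻¹}
      -- from those between the two pairs.
      Δ-quad : ∀ c₀ c₁ c₂ → let D = λ x y → ⟦ x ⊖ y ≟ t ⟧ ; e = α x in
        (D x x * c₀ + (D x (x ⁻¹) * c₀ + (D x e * c₂ + (D x (e ⁻¹) * c₂ + 0)))) +
        ((D (x ⁻¹) x * c₀ + (D (x ⁻¹) (x ⁻¹) * c₀ + (D (x ⁻¹) e * c₂ + (D (x ⁻¹) (e ⁻¹) * c₂ + 0)))) +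
        ((D e x * c₁ + (D e (x ⁻¹) * c₁ + (D e e * c₀ + (D e (e ⁻¹) * c₀ + 0)))) +
        ((D (e ⁻¹) x * c₁ + (D (e ⁻¹) (x ⁻¹) * c₁ + (D (e ⁻¹) e * c₀ + (D (e ⁻¹) (e ⁻¹) * c₀ + 0)))) + 0)))
        ≡ c₀ * (4 * z) + c₀ * ((S x + Sα x) + (S (x ⁻¹) + Sα (x ⁻¹))) + (c₁ + c₂) * ((D₋ x + D₊ x) + (D₋ (x ⁻¹) + D₊ (x ⁻¹)))
      Δ-quad c₀ c₁ c₂
        rewrite α-⁻¹ x | ⁻¹-involutive x | ⁻¹-involutive (α x) | inverseʳ x | inverseˡ x | inverseˡ (α x)
              | inverseʳ (α x) | comm (α x) (x ⁻¹) | comm (α x) x | comm (α x ⁻¹) (x ⁻¹) | comm (α x ⁻¹) x =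
        solve 12 (λ c₀ c₁ c₂ z S S′ Sα Sα′ D₋ D₋′ D₊ D₊′ →
            (z :* c₀ :+ (S :* c₀ :+ (D₋ :* c₂ :+ (D₊ :* c₂ :+ con 0)))) :+
            ((S′ :* c₀ :+ (z :* c₀ :+ (D₊′ :* c₂ :+ (D₋′ :* c₂ :+ con 0)))) :+
            ((D₋′ :* c₁ :+ (D₊ :* c₁ :+ (z :* c₀ :+ (Sα :* c₀ :+ con 0)))) :+
            ((D₊′ :* c₁ :+ (D₋ :* c₁ :+ (Sα′ :* c₀ :+ (z :* c₀ :+ con 0)))) :+ con 0)))
            := c₀ :* (con 4 :* z) :+ c₀ :* ((S :+ Sα) :+ (S′ :+ Sα′)) :+ (c₁ :+ c₂) :* ((D₋ :+ D₊) :+ (D₋′ :+ D₊′)))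
          refl c₀ c₁ c₂ z (S x) (S (x ⁻¹)) (Sα x) ⟦ α x ⁻¹ ∙ α x ⁻¹ ≟ t ⟧ (D₋ x) ⟦ x ⁻¹ ∙ α x ≟ t ⟧ (D₊ x) ⟦ x ⁻¹ ∙ α x ⁻¹ ≟ t ⟧

-- Quads from a splitting automorphism

record Splitting (q : ℕ) : Set₁ where
  field
    group        : OddGroup q
    automorphism : SplittingAutomorphism group
  open OddGroup group public
  open SplittingAutomorphism automorphism public
  open HalfSystem (halfSystem group) public

  quad : Carrier → List Carrier
  quad x = x ∷ x ⁻¹ ∷ α x ∷ α x ⁻¹ ∷ []

  module _ (t : Carrier) where

    -- Half of the twelve differences of `quad x`; the other half is the weight of x⁻¹. Each bracket
    -- belongs to a permutation of G and sums to 1 over G, so the index is 1 + 1 + 2 · (1 + 1).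
    weight : Carrier → ℕ
    weight x = (S t x + Sα t x) + 2 * (D₋ t x + D₊ t x)

    weight-ε : weight ε ≡ 6 * z t
    weight-ε rewrite S-ε t | Sα-ε t | D₋-ε t | D₊-ε t =
      solve 1 (λ z → (z :+ z) :+ con 2 :* (z :+ z) := con 6 :* z) refl (z t)
      where open +-*-Solver using (solve; _:+_; _:*_; _:=_; con)

    ∑-weight : ∑ elements weight ≡ 6
    ∑-weight = begin
      ∑ elements weight
        ≡⟨ ∑-+ elements _ _ ⟩
      ∑ elements (λ x → S t x + Sα t x) + ∑ elements (λ x → 2 * (D₋ t x + D₊ t x))
        ≡⟨ cong₂ _+_ (∑-+ elements (S t) (Sα t)) (trans (∑-*ˡ elements 2 _) (cong (2 *_) (∑-+ elements (D₋ t) (D₊ t)))) ⟩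
      (∑ elements (S t) + ∑ elements (Sα t)) + 2 * (∑ elements (D₋ t) + ∑ elements (D₊ t))
        ≡⟨ cong₂ (λ u v → u + 2 * v) (cong₂ _+_ (∑S t) (∑Sα t)) (cong₂ _+_ (∑D₋ t) (∑D₊ t)) ⟩
      6 ∎

    Δ-quad-weight : z t ≡ 0 → ∀ x → Δ t (quad x) ≡ weight x + weight (x ⁻¹)
    Δ-quad-weight z≡0 x = begin
      Δ t (quad x)
        ≡⟨ ∑-cong (quad x) (λ y → ∑-cong (quad x) (λ y′ → sym (*-identityʳ ⟦ y ⊖ y′ ≟ t ⟧))) ⟩
      ∑ (quad x) (λ y → ∑ (quad x) (λ y′ → ⟦ y ⊖ y′ ≟ t ⟧ * 1))
        ≡⟨ Δ-quad t x 1 1 1 ⟩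
      1 * (4 * z t) + 1 * ((S t x + Sα t x) + (S t (x ⁻¹) + Sα t (x ⁻¹))) + 2 * ((D₋ t x + D₊ t x) + (D₋ t (x ⁻¹) + D₊ t (x ⁻¹)))
        ≡⟨ cong (λ u → 1 * (4 * u) + 1 * ((S t x + Sα t x) + (S t (x ⁻¹) + Sα t (x ⁻¹))) + 2 * ((D₋ t x + D₊ t x) + (D₋ t (x ⁻¹) + D₊ t (x ⁻¹)))) z≡0 ⟩
      1 * 0 + 1 * ((S t x + Sα t x) + (S t (x ⁻¹) + Sα t (x ⁻¹))) + 2 * ((D₋ t x + D₊ t x) + (D₋ t (x ⁻¹) + D₊ t (x ⁻¹)))
        ≡⟨ solve 4 (λ a b c d → con 1 :* con 0 :+ con 1 :* (a :+ b) :+ con 2 :* (c :+ d) := (a :+ con 2 :* c) :+ (b :+ con 2 :* d)) refl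
             (S t x + Sα t x) (S t (x ⁻¹) + Sα t (x ⁻¹)) (D₋ t x + D₊ t x) (D₋ t (x ⁻¹) + D₊ t (x ⁻¹)) ⟩
      weight x + weight (x ⁻¹) ∎
      where open +-*-Solver using (solve; _:+_; _:*_; _:=_; con)

    -- Of the six pairs in the quad only {x⁻¹, (α x)⁻¹} lies in neither triple. The pair {x, α x},
    -- which has the same two differences, lies in both and makes up for it.
    Δ-triples-weight : z t ≡ 0 → ∀ x →
      Δ t (x ∷ x ⁻¹ ∷ α x ∷ []) + Δ t (x ∷ α x ∷ α x ⁻¹ ∷ []) ≡ weight x + weight (x ⁻¹)
    Δ-triples-weight z≡0 x = begin
      Δ t (x ∷ x ⁻¹ ∷ α x ∷ []) + Δ t (x ∷ α x ∷ α x ⁻¹ ∷ [])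
        ≡⟨ cong₂ _+_ (Δ-triple₁ t x) (Δ-triple₂ t x) ⟩
      3 * z t + D±S + (3 * z t + D±Sα)
        ≡⟨ cong (λ u → 3 * u + D±S + (3 * u + D±Sα)) z≡0 ⟩
      D±S + D±Sα
        ≡⟨ solve 8 (λ m m′ p p′ s s′ a a′ →
             (m :+ m′ :+ (p :+ p′) :+ (s :+ s′)) :+ (m :+ m′ :+ (p :+ p′) :+ (a :+ a′))
             := ((s :+ a) :+ con 2 :* (m :+ p)) :+ ((s′ :+ a′) :+ con 2 :* (m′ :+ p′))) refl
             (D₋ t x) (D₋ t (x ⁻¹)) (D₊ t x) (D₊ t (x ⁻¹)) (S t x) (S t (x ⁻¹)) (Sα t x) (Sα t (x ⁻¹)) ⟩
      weight x + weight (x ⁻¹) ∎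
      where
      open +-*-Solver using (solve; _:+_; _:*_; _:=_; con)
      D±S D±Sα : ℕ
      D±S = D₋ t x + D₋ t (x ⁻¹) + (D₊ t x + D₊ t (x ⁻¹)) + (S t x + S t (x ⁻¹))
      D±Sα = D₋ t x + D₋ t (x ⁻¹) + (D₊ t x + D₊ t (x ⁻¹)) + (Sα t x + Sα t (x ⁻¹))

module _ {q : ℕ} (Sp : Splitting q) where
  open Splitting Sp

  -- The differences of the quad {d, d⁻¹, α d, (α d)⁻¹} are those of two triples
  -- contained in it; replacing the quad by these triples accommodates ∞.
  quadDesign : ∀ {d ds} → half ≡ d ∷ ds → QuadDesign group
  quadDesign {d} {ds} half≡ = record
    { full             = map quad ds
    ; punctured        = (d ∷ d ⁻¹ ∷ α d ∷ []) ∷ (d ∷ α d ∷ α d ⁻¹ ∷ []) ∷ []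
    ; full-simple      = All.map⁺ (All.map (λ x≢ε → quad-unique x≢ε , refl) (All.tail nonzero))
    ; punctured-simple = (triple₁ (All.head nonzero) , refl) ∷ (triple₂ (All.head nonzero) , refl) ∷ []
    ; infinite-pairs   = refl
    ; differences      = λ t t≢ε → diffs t (⟦⟧-no (ε ≟ t) (t≢ε ∘ sym))
    } , trans (cong (_+ 1) (length-map quad ds)) (trans (+-comm _ 1) (cong length (sym half≡)))
    where
    nonzero : All (_≢ ε) (d ∷ ds)
    nonzero = subst (All (_≢ ε)) half≡ half-≢ε

    triple₁ : ∀ {x} → x ≢ ε → Unique (x ∷ x ⁻¹ ∷ α x ∷ [])
    triple₁ x≢ε = (x≢x⁻¹ x≢ε ∷ x≢αx x≢ε ∷ []) ∷ (x⁻¹≢αx x≢ε ∷ []) ∷ [] ∷ []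

    triple₂ : ∀ {x} → x ≢ ε → Unique (x ∷ α x ∷ α x ⁻¹ ∷ [])
    triple₂ x≢ε = (x≢αx x≢ε ∷ x≢αx⁻¹ x≢ε ∷ []) ∷ (x≢x⁻¹ (αx≢ε x≢ε) ∷ []) ∷ [] ∷ []

    diffs : ∀ t → z t ≡ 0 →
      ∑ (map quad ds ++ (d ∷ d ⁻¹ ∷ α d ∷ []) ∷ (d ∷ α d ∷ α d ⁻¹ ∷ []) ∷ []) (Δ t) ≡ 6
    diffs t z≡0 = begin
      ∑ (map quad ds ++ (d ∷ d ⁻¹ ∷ α d ∷ []) ∷ (d ∷ α d ∷ α d ⁻¹ ∷ []) ∷ []) (Δ t)
        ≡⟨ ∑-++ (map quad ds) _ (Δ t) ⟩
      ∑ (map quad ds) (Δ t) + (Δ t (d ∷ d ⁻¹ ∷ α d ∷ []) + (Δ t (d ∷ α d ∷ α d ⁻¹ ∷ []) + 0))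
        ≡⟨ cong₂ _+_ (trans (∑-map quad ds (Δ t)) (∑-cong ds (Δ-quad-weight t z≡0)))
             (trans (cong (Δ t (d ∷ d ⁻¹ ∷ α d ∷ []) +_) (+-identityʳ _)) (Δ-triples-weight t z≡0 d)) ⟩
      ∑ ds w± + w± d
        ≡⟨ +-comm (∑ ds w±) (w± d) ⟩
      ∑ (d ∷ ds) w±
        -- For t ≢ ε the weight of ε vanishes, so it can be added to reach the sum over G.
        ≡⟨ cong₂ _+_ (trans (weight-ε t) (cong (6 *_) z≡0)) (cong (λ l → ∑ l w±) half≡) ⟨
      weight t ε + ∑ half w±
        ≡⟨ ∑-half (weight t) ⟩
      ∑ elements (weight t)
        ≡⟨ ∑-weight t ⟩
      6 ∎
      where
      w± : Carrier → ℕ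
      w± x = weight t x + weight t (x ⁻¹)

-- Cyclic groups and products

isAbelianGroup-≡ : ∀ {A : Set} {_∙_ : A → A → A} {ε : A} {_⁻¹ : A → A} →
  Associative _≡_ _∙_ → Commutative _≡_ _∙_ → LeftIdentity _≡_ ε _∙_ → LeftInverse _≡_ ε _⁻¹ _∙_ →
  IsAbelianGroup _≡_ _∙_ ε _⁻¹
isAbelianGroup-≡ {_∙_ = _∙_} {_⁻¹ = _⁻¹} assoc comm idˡ invˡ = record
  { isGroup = record
    { isMonoid = record
      { isSemigroup = record
        { isMagma = record { isEquivalence = isEquivalence ; ∙-cong = cong₂ _∙_ }
        ; assoc   = assoc
        }
      ; identity = comm∧idˡ⇒id comm idˡ
      }
    ; inverse = comm∧invˡ⇒inv comm invˡ
    ; ⁻¹-cong = cong _⁻¹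
    }
  ; comm = comm
  }

permutes-cong : {f g : A → A} → (∀ x → f x ≡ g x) → Permutes f → Permutes g
permutes-cong f≗g (h , hf , fh) =
  h , (λ x → trans (cong h (sym (f≗g x))) (hf x)) , (λ x → trans (sym (f≗g (h x))) (fh x))

permutes-× : {f : A → A} {g : B → B} → Permutes f → Permutes g → Permutes (Product.map f g)
permutes-× (h , hf , fh) (k , kg , gk) =
  Product.map h k , (λ (x , y) → cong₂ _,_ (hf x) (kg y)) , (λ (x , y) → cong₂ _,_ (fh x) (gk y))

infixr 6 _×ᴳ_ _×ˢ_

_×ᴳ_ : ∀ {q r} → OddGroup q → OddGroup r → OddGroup (q * r)
_×ᴳ_ {q} {r} G H = record
  { Carrier = G.Carrier × H.Carrier
  ; _∙_     = λ x y → proj₁ x G.∙ proj₁ y , proj₂ x H.∙ proj₂ y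
  ; ε       = G.ε , H.ε
  ; _⁻¹     = Product.map G._⁻¹ H._⁻¹
  ; isAbelianGroup = isAbelianGroup-≡
      (λ (x , x′) (y , y′) (z , z′) → cong₂ _,_ (G.assoc x y z) (H.assoc x′ y′ z′))
      (λ (x , x′) (y , y′) → cong₂ _,_ (G.comm x y) (H.comm x′ y′))
      (λ (x , x′) → cong₂ _,_ (G.identityˡ x) (H.identityˡ x′))
      (λ (x , x′) → cong₂ _,_ (G.inverseˡ x) (H.inverseˡ x′))
  ; index   = ↔-sym (*↔× {q} {r}) ↔-∘ (G.index ×-↔ H.index)
  ; double-permutes = permutes-× G.double-permutes H.double-permutes
  }
  where
  module G = OddGroup G
  module H = OddGroup H

_×ˢ_ : ∀ {q r} → Splitting q → Splitting r → Splitting (q * r)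
G ×ˢ H = record
  { group        = G.group ×ᴳ H.group
  ; automorphism = record
    { α             = Product.map G.α H.α
    ; α-homo        = λ (x , x′) (y , y′) → cong₂ _,_ (G.α-homo x y) (H.α-homo x′ y′)
    ; α-permutes    = permutes-× G.α-permutes H.α-permutes
    ; id+α-permutes = permutes-× G.id+α-permutes H.id+α-permutes
    ; id-α-permutes = permutes-× G.id-α-permutes H.id-α-permutes
    }
  }
  where
  module G = Splitting G
  module H = Splitting H

module Cyclic (m : ℕ) where
  N : ℕ
  N = suc m

  [_] : ℕ → Fin N
  [ a ] = a mod N

  toℕ-[] : ∀ a → toℕ [ a ] ≡ a % N
  toℕ-[] a = toℕ-fromℕ< (m%n<n a N)

  []-cong : ∀ a b → a % N ≡ b % N → [ a ] ≡ [ b ]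
  []-cong a b eq = toℕ-injective (trans (toℕ-[] a) (trans eq (sym (toℕ-[] b))))

  [toℕ] : ∀ x → [ toℕ x ] ≡ x
  [toℕ] x = toℕ-injective (trans (toℕ-[] (toℕ x)) (m<n⇒m%n≡m (toℕ<n x)))

  [a+kn]≡[a] : ∀ a k → [ a + k * N ] ≡ [ a ]
  [a+kn]≡[a] a k = []-cong (a + k * N) a ([m+kn]%n≡m%n a k N)

  infixl 6 _⊕_
  infixr 7 _⊙_

  _⊕_ : Fin N → Fin N → Fin N
  x ⊕ y = [ toℕ x + toℕ y ]

  _⊙_ : ℕ → Fin N → Fin N
  k ⊙ x = [ k * toℕ x ]

  []-⊕ : ∀ a b → [ a ] ⊕ [ b ] ≡ [ a + b ]
  []-⊕ a b = trans (cong₂ (λ u v → [ u + v ]) (toℕ-[] a) (toℕ-[] b)) ([]-cong (a % N + b % N) (a + b) (sym (%-distribˡ-+ a b N)))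

  ⊙-[] : ∀ k a → k ⊙ [ a ] ≡ [ k * a ]
  ⊙-[] k a = trans (cong (λ u → [ k * u ]) (toℕ-[] a)) ([]-cong (k * (a % N)) (k * a) (begin
    k * (a % N) % N               ≡⟨ %-distribˡ-* k (a % N) N ⟩
    (k % N) * (a % N % N) % N     ≡⟨ cong (λ u → (k % N) * u % N) (m%n%n≡m%n a N) ⟩
    (k % N) * (a % N) % N         ≡⟨ %-distribˡ-* k a N ⟨
    k * a % N                     ∎))

  ⊕-[]ʳ : ∀ x b → x ⊕ [ b ] ≡ [ toℕ x + b ]
  ⊕-[]ʳ x b = trans (cong (_⊕ [ b ]) (sym ([toℕ] x))) ([]-⊕ (toℕ x) b)

  ⊕-[]ˡ : ∀ a y → [ a ] ⊕ y ≡ [ a + toℕ y ]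
  ⊕-[]ˡ a y = trans (cong ([ a ] ⊕_) (sym ([toℕ] y))) ([]-⊕ a (toℕ y))

  ⊕-comm : ∀ x y → x ⊕ y ≡ y ⊕ x
  ⊕-comm x y = cong [_] (+-comm (toℕ x) (toℕ y))

  ⊕-assoc : ∀ x y z → (x ⊕ y) ⊕ z ≡ x ⊕ (y ⊕ z)
  ⊕-assoc x y z = begin
    (x ⊕ y) ⊕ z                  ≡⟨ ⊕-[]ˡ (toℕ x + toℕ y) z ⟩
    [ toℕ x + toℕ y + toℕ z ]    ≡⟨ cong [_] (+-assoc (toℕ x) _ _) ⟩
    [ toℕ x + (toℕ y + toℕ z) ]  ≡⟨ ⊕-[]ʳ x (toℕ y + toℕ z) ⟨
    x ⊕ (y ⊕ z)                  ∎

  ⊙-⊕ : ∀ k x y → k ⊙ (x ⊕ y) ≡ k ⊙ x ⊕ k ⊙ y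
  ⊙-⊕ k x y = begin
    k ⊙ (x ⊕ y)                     ≡⟨ ⊙-[] k (toℕ x + toℕ y) ⟩
    [ k * (toℕ x + toℕ y) ]         ≡⟨ cong [_] (*-distribˡ-+ k (toℕ x) (toℕ y)) ⟩
    [ k * toℕ x + k * toℕ y ]       ≡⟨ []-⊕ (k * toℕ x) (k * toℕ y) ⟨
    k ⊙ x ⊕ k ⊙ y                   ∎

  ⊙-⊙ : ∀ k l x → k ⊙ l ⊙ x ≡ (k * l) ⊙ x
  ⊙-⊙ k l x = trans (⊙-[] k (l * toℕ x)) (cong [_] (sym (*-assoc k l (toℕ x))))

  x⊕k⊙x : ∀ k x → x ⊕ k ⊙ x ≡ suc k ⊙ x
  x⊕k⊙x k x = ⊕-[]ʳ x (k * toℕ x)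

  1+jn-⊙ : ∀ j x → (1 + j * N) ⊙ x ≡ x
  1+jn-⊙ j x = begin
    [ toℕ x + j * N * toℕ x ]    ≡⟨ cong (λ u → [ toℕ x + u ]) (solve 3 (λ j N x → j :* N :* x := j :* x :* N)
          refl j N (toℕ x)) ⟩
    [ toℕ x + j * toℕ x * N ]    ≡⟨ [a+kn]≡[a] (toℕ x) (j * toℕ x) ⟩
    [ toℕ x ]                    ≡⟨ [toℕ] x ⟩
    x                            ∎
    where open +-*-Solver using (solve; _:*_; _:=_)

  -- The equation in ℕ certifies that l inverts k modulo N, with quotient j; for families of moduli
  -- it is a polynomial identity.
  ⊙-permutes : ∀ k l j → k * l ≡ 1 + j * N → Permutes (k ⊙_)
  ⊙-permutes k l j eq = (l ⊙_) , (λ x → cancel l k (trans (*-comm l k) eq) x) , cancel k l eq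
    where
    cancel : ∀ k l → k * l ≡ 1 + j * N → ∀ x → k ⊙ l ⊙ x ≡ x
    cancel k l eq x = trans (⊙-⊙ k l x) (trans (cong (_⊙ x) eq) (1+jn-⊙ j x))

  cyclic : ∀ l j → 2 * l ≡ 1 + j * N → OddGroup N
  cyclic l j eq = record
    { Carrier = Fin N
    ; _∙_     = _⊕_
    ; ε       = zero
    -- Modulo N = 1 + m the number m represents -1.
    ; _⁻¹     = m ⊙_
    ; isAbelianGroup = isAbelianGroup-≡ ⊕-assoc ⊕-comm [toℕ]
        (λ x → trans (⊕-comm (m ⊙ x) x) (trans (x⊕k⊙x m x)
          (trans (cong [_] (*-comm N (toℕ x))) ([a+kn]≡[a] 0 (toℕ x)))))
    ; index   = ↔-id (Fin N)
    ; double-permutes = permutes-cong (λ x → cong (λ u → [ toℕ x + u ]) (+-identityʳ (toℕ x)))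
        (⊙-permutes 2 l j eq)
    }

  cyclicSplitting : ∀ l j → 2 * l ≡ 1 + j * N → ∀ l′ j′ → 3 * l′ ≡ 1 + j′ * N → Splitting N
  cyclicSplitting l j eq l′ j′ eq′ = record
    { group        = cyclic l j eq
    ; automorphism = record
      { α             = 2 ⊙_
      ; α-homo        = ⊙-⊕ 2
      ; α-permutes    = ⊙-permutes 2 l j eq
      ; id+α-permutes = permutes-cong (sym ∘ x⊕k⊙x 2) (⊙-permutes 3 l′ j′ eq′)
      ; id-α-permutes = permutes-cong
          (λ x → sym (trans (cong (x ⊕_) (⊙-⊙ m 2 x)) (x⊕k⊙x (m * 2) x)))
          -- Here 1 - α is multiplication by 1 - 2 = -1, represented by 1 + 2m. It is its own
          -- inverse, its square being 1 + 4m · N.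
          (⊙-permutes (suc (m * 2)) (suc (m * 2)) (4 * m)
            (solve 1 (λ m → (con 1 :+ m :* con 2) :* (con 1 :+ m :* con 2)
                         := con 1 :+ con 4 :* m :* (con 1 :+ m)) refl m))
      }
    }
    where open +-*-Solver using (solve; _:*_; _:=_; con; _:+_)

ℤ₃ : OddGroup 3
ℤ₃ = Cyclic.cyclic 2 2 1 refl

-- The automorphism is multiplication by i on 𝔽₉ = 𝔽₃[i].
ninefold : Splitting 9
ninefold = record
  { group        = ℤ₃ ×ᴳ ℤ₃
  ; automorphism = record
    { α             = rotate
    ; α-homo        = λ (x , x′) (y , y′) → cong (_, x ∙ y) (sym (⁻¹-∙-comm x′ y′))
    -- The three inverses are multiplication by -i, i - 1 and -1 - i; the last two come from (1 +
    -- i)(1 - i) = 2 = -1 in characteristic 3.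
    ; α-permutes    = (λ (a , b) → b , a ⁻¹) , toWitness² tt , toWitness² tt
    ; id+α-permutes = (λ (a , b) → (a ∙ b) ⁻¹ , a ⊖ b) , toWitness² tt , toWitness² tt
    ; id-α-permutes = (λ (a , b) → b ⊖ a , (a ∙ b) ⁻¹) , toWitness² tt , toWitness² tt
    }
  }
  where
  open OddGroup ℤ₃
  rotate : Carrier × Carrier → Carrier × Carrier
  rotate (x , y) = y ⁻¹ , x

  toWitness² : {f : Fin 3 × Fin 3 → Fin 3 × Fin 3} →
               True (all? λ x → all? λ y → ≡-dec Fin._≟_ Fin._≟_ (f (x , y)) (x , y)) → ∀ p → f p ≡ p
  toWitness² check (x , y) = toWitness check x y

-- Orders with exactly one factor 3 left over

module Tripled {u : ℕ} (Sp : Splitting u) where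
  open Splitting Sp
  private module Z = OddGroup ℤ₃
  group₃ : OddGroup (u * 3)
  group₃ = group ×ᴳ ℤ₃
  private module H = OddGroup group₃
  private module HH = HalfSystem (halfSystem group₃)

  -- Differences within {x, x⁻¹} or {α x, (α x)⁻¹} stay on level 0, while those between the two
  -- pairs fall on level 1 or 2 according to direction. Over `half`, each level receives every t ≢ ε
  -- twice: level 0 from the doubles `S` and `Sα`, the other two from `D₋` and `D₊`.
  quad₃ : Carrier → List H.Carrier
  quad₃ x = (x , zero) ∷ (x ⁻¹ , zero) ∷ (α x , suc zero) ∷ (α x ⁻¹ , suc zero) ∷ []

  fiber : List H.Carrier
  fiber = (ε , zero) ∷ (ε , suc zero) ∷ (ε , suc (suc zero)) ∷ []

  quads₃ : List (List H.Carrier)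
  quads₃ = map quad₃ half

  Δ-split : ∀ t k B → H.Δ (t , k) B ≡
    ∑ B λ p → ∑ B λ p′ → ⟦ proj₁ p ⊖ proj₁ p′ ≟ t ⟧ * ⟦ proj₂ p Z.⊖ proj₂ p′ Z.≟ k ⟧
  Δ-split t k B = ∑-cong B λ p → ∑-cong B λ p′ → trans
    (⟦⟧-⇔ (p H.⊖ p′ H.≟ (t , k)) ((proj₁ p ⊖ proj₁ p′ ≟ t) ×-dec (proj₂ p Z.⊖ proj₂ p′ Z.≟ k))
      (λ { refl → refl , refl }) (λ { (refl , refl) → refl }))
    (bit-∧ (does (proj₁ p ⊖ proj₁ p′ ≟ t)) _)

  -- The fibre is a subgroup of order 3, so each of its elements is a difference three times and
  -- nothing else is.
  Δ-fiber : ∀ t k → H.Δ (t , k) fiber ≡ 3 * z t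
  Δ-fiber t k = trans (Δ-split t k fiber) (lemma k)
    where
    open +-*-Solver using (solve; _:+_; _:*_; _:=_; con)
    lemma : ∀ k → ∑ fiber (λ p → ∑ fiber λ p′ → ⟦ proj₁ p ⊖ proj₁ p′ ≟ t ⟧ * ⟦ proj₂ p Z.⊖ proj₂ p′ Z.≟ k ⟧) ≡ 3 * z t
    lemma k rewrite inverseʳ ε with k
    ... | zero = solve 1 (λ z → (z :* con 1 :+ (z :* con 0 :+ (z :* con 0 :+ con 0)))
        :+ ((z :* con 0 :+ (z :* con 1 :+ (z :* con 0 :+ con 0)))
        :+ ((z :* con 0 :+ (z :* con 0 :+ (z :* con 1 :+ con 0))) :+ con 0)) := con 3 :* z) refl (z t)
    ... | suc zero = solve 1 (λ z → (z :* con 0 :+ (z :* con 0 :+ (z :* con 1 :+ con 0)))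
        :+ ((z :* con 1 :+ (z :* con 0 :+ (z :* con 0 :+ con 0)))
        :+ ((z :* con 0 :+ (z :* con 1 :+ (z :* con 0 :+ con 0))) :+ con 0)) := con 3 :* z) refl (z t)
    ... | suc (suc zero) = solve 1 (λ z → (z :* con 0 :+ (z :* con 1 :+ (z :* con 0 :+ con 0)))
        :+ ((z :* con 0 :+ (z :* con 0 :+ (z :* con 1 :+ con 0)))
        :+ ((z :* con 1 :+ (z :* con 0 :+ (z :* con 0 :+ con 0))) :+ con 0)) := con 3 :* z) refl (z t)

  doubles mixed : Carrier → Carrier → ℕ
  doubles t x = S t x + Sα t x
  mixed t x = D₋ t x + D₊ t x

  ∑-doubles : ∀ t → ∑ half (λ x → doubles t x + doubles t (x ⁻¹)) + 2 * z t ≡ 2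
  ∑-doubles t = begin
    ∑ half (λ x → doubles t x + doubles t (x ⁻¹)) + 2 * z t  ≡⟨ +-comm _ (2 * z t) ⟩
    2 * z t + ∑ half (λ x → doubles t x + doubles t (x ⁻¹))
      ≡⟨ cong (_+ ∑ half (λ x → doubles t x + doubles t (x ⁻¹))) (cong₂ _+_ (S-ε t) (trans (Sα-ε t) (sym (+-identityʳ (z t))))) ⟨
    doubles t ε + ∑ half (λ x → doubles t x + doubles t (x ⁻¹))   ≡⟨ ∑-half (doubles t) ⟩
    ∑ elements (doubles t)                              ≡⟨ ∑-+ elements (S t) (Sα t) ⟩
    ∑ elements (S t) + ∑ elements (Sα t)            ≡⟨ cong₂ _+_ (∑S t) (∑Sα t) ⟩
    2                                              ∎

  ∑-mixed : ∀ t → ∑ half (λ x → mixed t x + mixed t (x ⁻¹)) + 2 * z t ≡ 2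
  ∑-mixed t = begin
    ∑ half (λ x → mixed t x + mixed t (x ⁻¹)) + 2 * z t  ≡⟨ +-comm _ (2 * z t) ⟩
    2 * z t + ∑ half (λ x → mixed t x + mixed t (x ⁻¹))
      ≡⟨ cong (_+ ∑ half (λ x → mixed t x + mixed t (x ⁻¹))) (cong₂ _+_ (D₋-ε t) (trans (D₊-ε t) (sym (+-identityʳ (z t))))) ⟨
    mixed t ε + ∑ half (λ x → mixed t x + mixed t (x ⁻¹))   ≡⟨ ∑-half (mixed t) ⟩
    ∑ elements (mixed t)                              ≡⟨ ∑-+ elements (D₋ t) (D₊ t) ⟩
    ∑ elements (D₋ t) + ∑ elements (D₊ t)            ≡⟨ cong₂ _+_ (∑D₋ t) (∑D₊ t) ⟩
    2                                              ∎

  -- The term `2 * z t` treats both cases at once: the quads give 2 off the fibre and 0 on it. Taken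
  -- three times, it becomes `6 * z t`, which is what two copies of the fibre contribute.
  ∑-Δ-quads₃ : ∀ t k → (t , k) ≢ H.ε → ∑ quads₃ (H.Δ (t , k)) + 2 * z t ≡ 2
  ∑-Δ-quads₃ t k t≢ε = trans (cong (_+ 2 * z t) (∑-map quad₃ half (H.Δ (t , k)))) (lemma k t≢ε)
    where
    open +-*-Solver using (solve; _:+_; _:*_; _:=_; con)
    lemma : ∀ k → (t , k) ≢ H.ε → ∑ half (λ x → H.Δ (t , k) (quad₃ x)) + 2 * z t ≡ 2
    -- The weights given to `Δ-quad` are the indicator of the level k. On level 0 the diagonal term
    -- `4 * z t` also appears, and it vanishes because (t , zero) ≢ (ε , zero) forces t ≢ ε.
    lemma zero t≢ε = trans (cong (_+ 2 * z t) (∑-cong half λ x → trans (Δ-split t zero (quad₃ x))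
      (trans (Δ-quad t x 1 0 0) (trans
        (cong (λ u → 1 * (4 * u) + 1 * (doubles t x + doubles t (x ⁻¹)) + 0) (⟦⟧-no (ε ≟ t) (λ { refl → t≢ε refl })))
        (solve 1 (λ a → con 0 :+ con 1 :* a :+ con 0 := a) refl (doubles t x + doubles t (x ⁻¹)))))))
      (∑-doubles t)
    lemma (suc zero) _ = trans (cong (_+ 2 * z t) (∑-cong half λ x → trans (Δ-split t (suc zero) (quad₃ x))
      (trans (Δ-quad t x 0 1 0) (+-identityʳ _)))) (∑-mixed t)
    lemma (suc (suc zero)) _ = trans (cong (_+ 2 * z t) (∑-cong half λ x → trans (Δ-split t (suc (suc zero)) (quad₃ x))
      (trans (Δ-quad t x 0 0 1) (+-identityʳ _)))) (∑-mixed t)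

  quad₃-unique : ∀ {x} → x ≢ ε → Unique (quad₃ x)
  quad₃-unique x≢ε =
    ((x≢x⁻¹ x≢ε ∘ cong proj₁) ∷ (λ ()) ∷ (λ ()) ∷ []) ∷ ((λ ()) ∷ (λ ()) ∷ [])
    ∷ ((x≢x⁻¹ (αx≢ε x≢ε) ∘ cong proj₁) ∷ []) ∷ [] ∷ []

  -- The quads develop into a group divisible design with groups of size 3;
  -- ∞ together with a group forms the remaining blocks.
  quadDesign₃ : QuadDesign group₃
  quadDesign₃ = record
    { full             = quads₃ ++ quads₃ ++ quads₃
    ; punctured        = fiber ∷ fiber ∷ []
    ; full-simple      = All.++⁺ simple (All.++⁺ simple simple)
    ; punctured-simple = fiber-simple ∷ fiber-simple ∷ []
    ; infinite-pairs   = refl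
    ; differences      = λ (t , k) → diffs t k
    } , size
    where
    open +-*-Solver using (solve; _:+_; _:*_; _:=_; con)

    simple : All (Simple 4) quads₃
    simple = All.map⁺ (All.map (λ x≢ε → quad₃-unique x≢ε , refl) half-≢ε)

    fiber-simple : Simple 3 fiber
    fiber-simple = (((λ ()) ∷ (λ ()) ∷ []) ∷ ((λ ()) ∷ []) ∷ [] ∷ []) , refl

    diffs : ∀ t k → (t , k) ≢ H.ε →
      ∑ ((quads₃ ++ quads₃ ++ quads₃) ++ fiber ∷ fiber ∷ []) (H.Δ (t , k)) ≡ 6
    diffs t k t≢ε = begin
      ∑ ((quads₃ ++ quads₃ ++ quads₃) ++ fiber ∷ fiber ∷ []) (H.Δ (t , k))
        ≡⟨ ∑-++ (quads₃ ++ quads₃ ++ quads₃) _ (H.Δ (t , k)) ⟩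
      ∑ (quads₃ ++ quads₃ ++ quads₃) (H.Δ (t , k)) + (H.Δ (t , k) fiber + (H.Δ (t , k) fiber + 0))
        ≡⟨ cong₂ _+_ (trans (∑-++ quads₃ _ (H.Δ (t , k))) (cong (∑Δ +_) (∑-++ quads₃ quads₃ (H.Δ (t , k)))))
             (cong (λ u → u + (u + 0)) (Δ-fiber t k)) ⟩
      (∑Δ + (∑Δ + ∑Δ)) + (3 * z t + (3 * z t + 0))
        ≡⟨ solve 2 (λ ∑Δ z → (∑Δ :+ (∑Δ :+ ∑Δ)) :+ (con 3 :* z :+ (con 3 :* z :+ con 0)) := con 3 :* (∑Δ :+ con 2 :* z)) refl ∑Δ (z t) ⟩
      3 * (∑Δ + 2 * z t)
        ≡⟨ cong (3 *_) (∑-Δ-quads₃ t k t≢ε) ⟩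
      6 ∎
      where
      ∑Δ : ℕ
      ∑Δ = ∑ quads₃ (H.Δ (t , k))

    size : length (quads₃ ++ quads₃ ++ quads₃) + 1 ≡ length HH.half
    size = *-cancelʳ-≡ _ _ 2 (suc-injective (begin
      suc ((length (quads₃ ++ quads₃ ++ quads₃) + 1) * 2)
        ≡⟨ cong (λ l → suc ((l + 1) * 2)) (trans (length-++ quads₃) (cong (length quads₃ +_) (length-++ quads₃))) ⟩
      suc ((length quads₃ + (length quads₃ + length quads₃) + 1) * 2)
        ≡⟨ cong (λ l → suc ((l + (l + l) + 1) * 2)) (length-map quad₃ half) ⟩
      suc ((length half + (length half + length half) + 1) * 2)
        ≡⟨ solve 1 (λ l → con 1 :+ (l :+ (l :+ l) :+ con 1) :* con 2 := (con 1 :+ l :* con 2) :* con 3)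
              refl (length half) ⟩
      (1 + length half * 2) * 3
        ≡⟨ cong (_* 3) q≡1+2∣half∣ ⟨
      u * 3
        ≡⟨ HH.q≡1+2∣half∣ ⟩
      1 + length HH.half * 2 ∎))

-- The 3-part of an odd q is a power of 9 or three times a power of 9.
odd-splitting : ∀ k → Splitting (1 + k * 2) ⊎ ∃ λ u → 1 + k * 2 ≡ u * 3 × Splitting u
odd-splitting = <-rec _ step
  where
  open +-*-Solver using (solve; _:+_; _:*_; _:=_; con)
  Goal : ℕ → Set₁
  Goal k = Splitting (1 + k * 2) ⊎ ∃ λ u → 1 + k * 2 ≡ u * 3 × Splitting u

  -- The order for 1 + 3j is three times the order for j. A first factor 3 is set aside; a second
  -- one combines with it into 9, which `ninefold` absorbs.
  multiple-of-3 : ∀ j → Goal j → Goal (1 + j * 3)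
  multiple-of-3 j (inj₁ Sp) = inj₂ (1 + j * 2 ,
    solve 1 (λ j → con 1 :+ (con 1 :+ j :* con 3) :* con 2 := (con 1 :+ j :* con 2) :* con 3) refl j , Sp)
  multiple-of-3 j (inj₂ (u , eq , Sp)) = inj₁ (subst Splitting (begin
      u * 9                   ≡⟨ *-assoc u 3 3 ⟨
      u * 3 * 3               ≡⟨ cong (_* 3) eq ⟨
      (1 + j * 2) * 3         ≡⟨ solve 1 (λ j → con 1 :+ (con 1 :+ j :* con 3) :* con 2 := (con 1 :+ j :* con 2) :* con 3) refl j ⟨
      1 + (1 + j * 3) * 2     ∎)
    (Sp ×ˢ ninefold))

  step : ∀ k → (∀ {j} → j < k → Goal j) → Goal k
  step k rec with k divMod 3
  -- Here N = 1 + 6j, and the inverses of 2 and 3 come from 2(1 + 3j) = 1 + N and 3(1 + 4j) = 1 +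
  -- 2N.
  ... | result j zero refl = inj₁ (Cyclic.cyclicSplitting (j * 3 * 2)
        (1 + j * 3) 1 (solve 1 (λ j → con 2 :* (con 1 :+ j :* con 3) := con 1 :+ con 1 :* (con 1 :+ j :* con 3 :* con 2)) refl j)
        (1 + 4 * j) 2 (solve 1 (λ j → con 3 :* (con 1 :+ con 4 :* j) := con 1 :+ con 2 :* (con 1 :+ j :* con 3 :* con 2)) refl j))
  ... | result j (suc zero) refl = multiple-of-3 j (rec (s≤s (m≤m*n j 3)))
  -- Here N = 5 + 6j, and 2(3 + 3j) = 3(2 + 2j) = 1 + N.
  ... | result j (suc (suc zero)) refl = inj₁ (Cyclic.cyclicSplitting ((2 + j * 3) * 2)
        (3 + 3 * j) 1 (solve 1 (λ j → con 2 :* (con 3 :+ con 3 :* j) := con 1 :+ con 1 :* (con 1 :+ (con 2 :+ j :* con 3) :* con 2)) refl j)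
        (2 + 2 * j) 1 (solve 1 (λ j → con 3 :* (con 2 :+ con 2 :* j) := con 1 :+ con 1 :* (con 1 :+ (con 2 :+ j :* con 3) :* con 2)) refl j))

-- Assembly for even n

GDD₂₄ : ℕ → ℕ → ℕ → Set
GDD₂₄ n λ₁ λ₂ = Σ (GDD n 2 6 λ₁ λ₂) (HasConfiguration 2 4)

quadDesign-gdd : ∀ {q} (G : OddGroup q) → QuadDesign G → ∀ k → q ≡ 1 + k * 2 → GDD₂₄ (suc q) (7 * suc k) (4 * q)
quadDesign-gdd {q} G D k q≡ =
  subst (λ h → GDD₂₄ (suc q) (7 * suc h) (4 * q))
    (*-cancelʳ-≡ _ _ 2 (suc-injective (trans (sym q≡1+2∣half∣) q≡)))
    (gdd F , gdd-configuration F)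
  where
  open HalfSystem (halfSystem G)
  F = factoredDesign G D

-- The parameters are n = 2(k + 2), h = n/2 = k + 2 and q = n - 1 = 1 + 2(k + 1). As q is at least
-- 3, `half` is nonempty and has a d whose quad can be exchanged for two triples.
even-gdd : ∀ k → GDD₂₄ (suc (1 + suc k * 2)) (7 * suc (suc k)) (4 * (1 + suc k * 2))
even-gdd k with odd-splitting (suc k)
... | inj₂ (u , eq , Sp) = subst (λ q → GDD₂₄ (suc q) (7 * suc (suc k)) (4 * q)) (sym eq)
  (quadDesign-gdd group₃ quadDesign₃ (suc k) (sym eq))
  where open Tripled Sp
... | inj₁ Sp = quadDesign-gdd group (nonempty half refl) (suc k) refl
  where
  open Splitting Sp
  nonempty : ∀ l → half ≡ l → QuadDesign group
  nonempty (d ∷ ds) eq = quadDesign Sp eq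
  nonempty []       eq with () ← trans q≡1+2∣half∣ (cong (λ l → 1 + length l * 2) eq)

corollary5p2 : (n : ℕ) → 4 ≤ n →
    n % 56 ∈ 2 ∷ 6 ∷ 10 ∷ 14 ∷ 18 ∷ 26 ∷ 30 ∷ 34 ∷ 38 ∷ 42 ∷ 46 ∷ 54 ∷ [] →
    Σ (GDD n 2 6 ((7 * n) / 2) (4 * (n ∸ 1))) (HasConfiguration 2 4)
corollary5p2 n 4≤n n%56∈ with 2∣n
  where
  -- The listed residues and the modulus 56 are all even.
  2∣n : 2 ∣ n
  2∣n = subst (2 ∣_) (sym (m≡m%n+[m/n]*n n 56)) (∣m∣n⇒∣m+n
    (All.lookup (from-yes (All.all? (2 ∣?_) (2 ∷ 6 ∷ 10 ∷ 14 ∷ 18 ∷ 26 ∷ 30 ∷ 34 ∷ 38 ∷ 42 ∷ 46 ∷ 54 ∷ []))) n%56∈)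
    (∣n⇒∣m*n (n / 56) (divides-refl 28)))
corollary5p2 _ (s≤s (s≤s ())) _ | divides (suc zero) refl
corollary5p2 _ _ _ | divides (suc (suc k)) refl =
  subst (λ λ₁ → GDD₂₄ (suc (suc k) * 2) λ₁ (4 * (suc (suc k) * 2 ∸ 1)))
    -- The division in λ₁ is exact, n being (k + 2) · 2.
    (sym (trans (cong (_/ 2) (sym (*-assoc 7 (suc (suc k)) 2))) (m*n/n≡m (7 * suc (suc k)) 2)))
    (even-gdd k)
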